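{- $\mathsf{WKL}$ admits preservation of the arithmetic hierarchy. That is, for every set $Z$ and every $Z$-computable infinite subtree $T \subseteq 2^{<\omega}$, there exists an infinite path $G \in [T]$ such that $G$ preserves the arithmetic hierarchy relative to $Z$.
   Context: For a set $X$ and $n>0$, $\Sigma^X_n$, $\Pi^X_n$, $\Delta^X_{n+1}$ denote the classes of subsets of $\omega$ that are $\Sigma^0_n$, $\Pi^0_n$, $\Delta^0_{n+1}$ relative to $X$. A set is properly $\Sigma^X_n$ if it is $\Sigma^X_n$ but not $\Pi^X_n$; properly $\Pi^X_n$ if it is $\Pi^X_n$ but not $\Sigma^X_n$; properly $\Delta^X_{n+1}$ if it is $\Delta^X_{n+1}$ but neither $\Sigma^X_n$ nor $\Pi^X_n$. For $\Xi$ among $\Delta^0_{n+1},\Pi^0_n,\Sigma^0_n$ ($n>0$), a set $Y$ preserves $\Xi$-definitions relative to $X$ if every set that is properly $\Xi$ relative to $X$ is properly $\Xi$ relative to $X\oplus Y$. $Y$ preserves the arithmetic hierarchy relative to $X$ if $Y$ preserves $\Xi$-definitions relative to $X$ for every such $\Xi$ and every $n>0$. $\mathsf{WKL}$ is the statement that every infinite subtree of $2^{<\omega}$ has an infinite path. -}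

module Defs where

open import Data.Nat using (ℕ; zero; suc; _+_; _*_; _<_; _≤_)
open import Data.Fin using (Fin)
open import Data.Bool using (Bool; true; false; if_then_else_)
open import Data.Vec using (Vec; []; _∷_; lookup; tabulate)
open import Data.List using (List; length; applyUpTo; _++_)
open import Data.Product using (Σ; ∃; _×_; _,_)
open import Data.Sum using (_⊎_)
open import Relation.Nullary using (¬_)
open import Relation.Binary.PropositionalEquality using (_≡_)
open import Function using (_⇔_)

SetOfNat : Set
SetOfNat = ℕ → Bool

LEM : Set₁
LEM = (P : Set) → P ⊎ ¬ P

-- Effective join X ⊕ Y : (X ⊕ Y)(2n) = X n, (X ⊕ Y)(2n+1) = Y n.
_⊕_ : SetOfNat → SetOfNat → SetOfNat
(X ⊕ Y) zero = X zero
(X ⊕ Y) (suc zero) = Y zero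
(X ⊕ Y) (suc (suc n)) = ((λ m → X (suc m)) ⊕ (λ m → Y (suc m))) n

b2n : Bool → ℕ
b2n true = 1
b2n false = 0

data PR : ℕ → Set where
  zer  : ∀ {k} → PR k
  succ : PR 1
  proj : ∀ {k} → Fin k → PR k
  orc  : PR 1
  comp : ∀ {k m} → PR m → (Fin m → PR k) → PR k
  prec : ∀ {k} → PR k → PR (suc (suc k)) → PR (suc k)
  mu   : ∀ {k} → PR (suc k) → PR k

data Eval (X : SetOfNat) : ∀ {k} → PR k → Vec ℕ k → ℕ → Set where
  e-zer  : ∀ {k} {xs : Vec ℕ k} → Eval X zer xs 0
  e-succ : ∀ {x} → Eval X succ (x ∷ []) (suc x)
  e-proj : ∀ {k} {i : Fin k} {xs} → Eval X (proj i) xs (lookup xs i)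
  e-orc  : ∀ {x} → Eval X orc (x ∷ []) (b2n (X x))
  e-comp : ∀ {k m} {f : PR m} {gs : Fin m → PR k} {xs} {ys : Fin m → ℕ} {z}
         → (∀ i → Eval X (gs i) xs (ys i))
         → Eval X f (tabulate ys) z
         → Eval X (comp f gs) xs z
  e-prec0 : ∀ {k} {g : PR k} {h} {xs} {z}
          → Eval X g xs z → Eval X (prec g h) (0 ∷ xs) z
  e-precS : ∀ {k} {g : PR k} {h} {n} {xs} {z} {w}
          → Eval X (prec g h) (n ∷ xs) z
          → Eval X h (n ∷ z ∷ xs) w
          → Eval X (prec g h) (suc n ∷ xs) w
  e-mu : ∀ {k} {f : PR (suc k)} {xs} {y}
       → Eval X f (y ∷ xs) 0
       → (∀ z → z < y → Σ ℕ λ v → Eval X f (z ∷ xs) (suc v))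
       → Eval X (mu f) xs y

ComputableRel : SetOfNat → (k : ℕ) → (Vec ℕ k → Bool) → Set
ComputableRel X k R = Σ (PR k) λ c → ∀ v → Eval X c v (b2n (R v))

mutual
  ExForm : (n : ℕ) → (Vec ℕ n → Set) → Set
  ExForm zero P = P []
  ExForm (suc n) P = Σ ℕ λ y → AllForm n (λ ys → P (y ∷ ys))

  AllForm : (n : ℕ) → (Vec ℕ n → Set) → Set
  AllForm zero P = P []
  AllForm (suc n) P = (y : ℕ) → ExForm n (λ ys → P (y ∷ ys))

IsΣ : SetOfNat → ℕ → SetOfNat → Set
IsΣ X n A = Σ (Vec ℕ (suc n) → Bool) λ R →
  ComputableRel X (suc n) R ×
  (∀ x → (A x ≡ true) ⇔ ExForm n (λ ys → R (x ∷ ys) ≡ true))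

IsΠ : SetOfNat → ℕ → SetOfNat → Set
IsΠ X n A = Σ (Vec ℕ (suc n) → Bool) λ R →
  ComputableRel X (suc n) R ×
  (∀ x → (A x ≡ true) ⇔ AllForm n (λ ys → R (x ∷ ys) ≡ true))

IsΔ : SetOfNat → ℕ → SetOfNat → Set
IsΔ X n A = IsΣ X n A × IsΠ X n A

ProperΣ : SetOfNat → ℕ → SetOfNat → Set
ProperΣ X n A = IsΣ X n A × ¬ IsΠ X n A

ProperΠ : SetOfNat → ℕ → SetOfNat → Set
ProperΠ X n A = IsΠ X n A × ¬ IsΣ X n A

ProperΔ : SetOfNat → ℕ → SetOfNat → Set
ProperΔ X n A = IsΔ X (suc n) A × ¬ IsΣ X n A × ¬ IsΠ X n A

PreservesAH : SetOfNat → SetOfNat → Set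
PreservesAH X Y = (n : ℕ) → 0 < n →
  ((A : SetOfNat) → ProperΣ X n A → ProperΣ (X ⊕ Y) n A) ×
  ((A : SetOfNat) → ProperΠ X n A → ProperΠ (X ⊕ Y) n A) ×
  ((A : SetOfNat) → ProperΔ X n A → ProperΔ (X ⊕ Y) n A)

-- Bijective coding of 2^{<ω} into ω.
encode : List Bool → ℕ
encode List.[] = 0
encode (false List.∷ s) = 2 * encode s + 1
encode (true List.∷ s) = 2 * encode s + 2

ComputableTree : SetOfNat → (List Bool → Bool) → Set
ComputableTree Z T = Σ (PR 1) λ c → ∀ s → Eval Z c (encode s ∷ []) (b2n (T s))

IsTree : (List Bool → Bool) → Set
IsTree T = ∀ s t → T (s ++ t) ≡ true → T s ≡ true

-- T is infinite (contains arbitrarily long strings; equivalent to having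
-- infinitely many nodes since there are finitely many strings of each length)
InfiniteTree : (List Bool → Bool) → Set
InfiniteTree T = ∀ n → Σ (List Bool) λ s → n ≤ length s × T s ≡ true

prefix : SetOfNat → ℕ → List Bool
prefix G n = applyUpTo G n

IsPath : (List Bool → Bool) → SetOfNat → Set
IsPath T G = ∀ n → T (prefix G n) ≡ true

{-# OPTIONS --safe #-}
-- Force with Z-computable infinite subtrees of T, presented as finite lists of Π₁ constraints.
-- For n ≥ 1 and a Π_n formula φ, the set of x for which some extension of a given condition
-- forces φ(x) is again Π_n in Z.  So if A is not Π_n in Z, it differs at some x from the set of x
-- at which φ is forceable, and some extension forces φ(x) to disagree with A(x).  A path through
-- a sequence of conditions that does this for all φ and all A arithmetical in Z reflects Π_n, and
-- by complementation Σ_n, definitions of such sets from Z ⊕ G to Z.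
module Submission where

open import Defs
open import Data.Bool using (Bool; true; false; if_then_else_; not; _∧_; _∨_)
open import Data.Bool.Properties using (not-involutive; ¬-not; not-¬)
open import Data.Fin using (Fin; zero; suc; toℕ; fromℕ<)
open import Data.Fin.Properties using (toℕ<n; toℕ-fromℕ<)
open import Data.List using (List; []; _∷_; _++_; length)
open import Data.List.Relation.Unary.Any using (Any; here; there)
open import Data.List.Relation.Unary.Any.Properties using (++⁺ˡ; ++⁺ʳ)
open import Data.Nat
open import Data.Nat.Properties
open import Data.Product using (Σ; _×_; _,_; proj₁; proj₂)
open import Data.Sum using (_⊎_; inj₁; inj₂)
open import Data.Unit using (⊤; tt)
open import Data.Vec using (Vec; []; _∷_; lookup; tabulate; head; tail)
open import Data.Vec.Properties using (tabulate∘lookup; lookup∘tabulate; tabulate-cong)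
open import Function using (_∘_; _⇔_; mk⇔; module Equivalence)
open import Relation.Binary.Definitions using (tri<; tri≈; tri>)
open import Relation.Binary.PropositionalEquality using (_≡_; refl; sym; trans; cong; cong₂; subst; module ≡-Reasoning)
open import Relation.Nullary using (¬_; contradiction; yes; no)

open Equivalence using (to; from)

-- Bounded search

-- Two obstacles shape the proof. First, forcing must not raise complexity, and a clause "some
-- extension forces φ" would put an existential quantifier over conditions in front of a Π
-- statement. `Forceable` avoids it. At a higher level the given condition itself has to force. This
-- is stricter than forcing by an extension, but its failure still yields an extension that refutes
-- the formula, and that dichotomy is all the construction uses. Second, requirements must be
-- countable, although A ranges over arbitrary functions into `Bool`. A properly Σ, Π or Δ set has a
-- Π definition over Z, hence a numerical code, and the requirements range over codes. Finally,
-- deciding in Z whether a finite string violates a constraint takes a bounded universal evaluator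
-- for the relation `Eval`; coded derivations supply it.

opaque
  any< : ℕ → (ℕ → Bool) → Bool
  any< zero f = false
  any< (suc n) f = f n ∨ any< n f

  all< : ℕ → (ℕ → Bool) → Bool
  all< n f = not (any< n (λ i → not (f i)))

  -- The largest witness below n, or 0 in its absence. With this default `find n f ≤ pred n` always
  -- holds, so that `snd` lowers every nonzero code.
  find : ℕ → (ℕ → Bool) → ℕ
  find zero f = 0
  find (suc n) f = if f n then n else find n f

∧-intro : ∀ {a b} → a ≡ true → b ≡ true → a ∧ b ≡ true
∧-intro refl refl = refl

∧-elim : ∀ {a b : Bool} → a ∧ b ≡ true → a ≡ true × b ≡ true
∧-elim {true} p = refl , p

∨-introˡ : ∀ {a b} → a ≡ true → a ∨ b ≡ true
∨-introˡ refl = refl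

∨-introʳ : ∀ {a b} → b ≡ true → a ∨ b ≡ true
∨-introʳ {true} p = refl
∨-introʳ {false} p = p

∨-elim : ∀ {a b} → a ∨ b ≡ true → a ≡ true ⊎ b ≡ true
∨-elim {true} p = inj₁ refl
∨-elim {false} p = inj₂ p

not-intro : ∀ {a} → ¬ a ≡ true → not a ≡ true
not-intro {false} p = refl
not-intro {true} p = contradiction refl p

not-elim : ∀ {a} → not a ≡ true → ¬ a ≡ true
not-elim {true} () _
not-elim {false} _ ()

opaque
  unfolding any< all< find

  any<-intro : ∀ n {f : ℕ → Bool} i → i < n → f i ≡ true → any< n f ≡ true
  any<-intro (suc n) i i<sn p with m≤n⇒m<n∨m≡n (≤-pred i<sn)
  ... | inj₁ i<n = ∨-introʳ (any<-intro n i i<n p)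
  ... | inj₂ refl = ∨-introˡ p

  any<-elim : ∀ n {f : ℕ → Bool} → any< n f ≡ true → Σ ℕ λ i → i < n × f i ≡ true
  any<-elim (suc n) p with ∨-elim p
  ... | inj₁ q = n , ≤-refl , q
  ... | inj₂ q with any<-elim n q
  ... | i , i<n , r = i , m≤n⇒m≤1+n i<n , r

  all<-intro : ∀ n {f : ℕ → Bool} → (∀ i → i < n → f i ≡ true) → all< n f ≡ true
  all<-intro n h = not-intro λ p →
    let i , i<n , q = any<-elim n p in not-elim q (h i i<n)

  all<-elim : ∀ n {f : ℕ → Bool} → all< n f ≡ true → ∀ i → i < n → f i ≡ true
  all<-elim n {f} p i i<n with f i in eq
  ... | true = refl
  ... | false = contradiction (any<-intro n i i<n (cong not eq)) (not-elim p)

  find-spec : ∀ n {f : ℕ → Bool} i → i < n → f i ≡ true → f (find n f) ≡ true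
  find-spec (suc n) {f} i i<sn p with f n in eq
  ... | true = eq
  ... | false with m≤n⇒m<n∨m≡n (≤-pred i<sn)
  ... | inj₁ i<n = find-spec n i i<n p
  ... | inj₂ refl = contradiction (trans (sym p) eq) λ ()

  find-≤ : ∀ n f → find n f ≤ pred n
  find-≤ zero f = z≤n
  find-≤ (suc n) f with f n
  ... | true = ≤-refl
  ... | false = ≤-trans (find-≤ n f) pred[n]≤n

≡ᵇ-elim : ∀ m n → (m ≡ᵇ n) ≡ true → m ≡ n
≡ᵇ-elim zero zero p = refl
≡ᵇ-elim (suc m) (suc n) p = cong suc (≡ᵇ-elim m n p)

≡ᵇ-refl : ∀ n → (n ≡ᵇ n) ≡ true
≡ᵇ-refl zero = refl
≡ᵇ-refl (suc n) = ≡ᵇ-refl n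

≡ᵇ-intro : ∀ {m n} → m ≡ n → (m ≡ᵇ n) ≡ true
≡ᵇ-intro {m} refl = ≡ᵇ-refl m

<ᵇ-elim : ∀ {m n} → (m <ᵇ n) ≡ true → m < n
<ᵇ-elim {zero} {suc n} p = s≤s z≤n
<ᵇ-elim {suc m} {suc n} p = s≤s (<ᵇ-elim p)

<ᵇ-intro : ∀ {m n} → m < n → (m <ᵇ n) ≡ true
<ᵇ-intro {zero} {suc n} p = refl
<ᵇ-intro {suc m} {suc n} p = <ᵇ-intro (≤-pred p)

-- Pairing and coded lists

-- The values `s * s + x` with x ≤ s stay below the next square, so different s give disjoint
-- blocks. Hence `pair` determines the sum of its components, and then the components.
square-gap : ∀ {s t x} → x ≤ s → s < t → s * s + x < t * t
square-gap {s} {t} {x} x≤s s<t = begin-strict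
  s * s + x      ≤⟨ +-monoʳ-≤ (s * s) x≤s ⟩
  s * s + s      ≡⟨ +-comm (s * s) s ⟩
  suc s * s      <⟨ *-monoʳ-< (suc s) ≤-refl ⟩
  suc s * suc s  ≤⟨ *-mono-≤ s<t s<t ⟩
  t * t          ∎
  where open ≤-Reasoning

m≤m*m : ∀ m → m ≤ m * m
m≤m*m zero = z≤n
m≤m*m (suc m) = m≤m+n (suc m) (m * suc m)

opaque
  -- The successor makes 0 available as the empty list.
  pair : ℕ → ℕ → ℕ
  pair x y = suc ((x + y) * (x + y) + x)

  fst snd : ℕ → ℕ
  fst z = find z (λ x → any< z (λ y → pair x y ≡ᵇ z))
  snd z = find z (λ y → any< z (λ x → pair x y ≡ᵇ z))

  pair≢0 : ∀ {x y} → ¬ pair x y ≡ 0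
  pair≢0 ()

  pair-injective : ∀ {x y x′ y′} → pair x y ≡ pair x′ y′ → x ≡ x′ × y ≡ y′
  pair-injective {x} {y} {x′} {y′} eq with <-cmp (x + y) (x′ + y′)
  ... | tri< lt _ _ = contradiction (suc-injective eq)
          (<⇒≢ (<-≤-trans (square-gap (m≤m+n x y) lt) (m≤m+n _ x′)))
  ... | tri> _ _ gt = contradiction (sym (suc-injective eq))
          (<⇒≢ (<-≤-trans (square-gap (m≤m+n x′ y′) gt) (m≤m+n _ x)))
  ... | tri≈ _ s≡s′ _ = x≡x′ , +-cancelˡ-≡ x y y′ (trans s≡s′ (cong (_+ y′) (sym x≡x′)))
    where
    x≡x′ : x ≡ x′
    x≡x′ = +-cancelˡ-≡ ((x + y) * (x + y)) x x′
      (trans (suc-injective eq) (cong (λ s → s * s + x′) (sym s≡s′)))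

  x<pair : ∀ x y → x < pair x y
  x<pair x y = s≤s (m≤n+m x _)

  y<pair : ∀ x y → y < pair x y
  y<pair x y = s≤s (≤-trans (m≤n+m y x) (≤-trans (m≤m*m (x + y)) (m≤m+n _ x)))

  fst-pair : ∀ x y → fst (pair x y) ≡ x
  fst-pair x y =
    let z = pair x y
        j , _ , q = any<-elim z (find-spec z {λ i → any< z (λ j → pair i j ≡ᵇ z)} x (x<pair x y)
                      (any<-intro z y (y<pair x y) (≡ᵇ-refl z)))
    in proj₁ (pair-injective {fst z} {j} {x} {y} (≡ᵇ-elim (pair (fst z) j) z q))

  snd-pair : ∀ x y → snd (pair x y) ≡ y
  snd-pair x y =
    let z = pair x y
        j , _ , q = any<-elim z (find-spec z {λ i → any< z (λ j → pair j i ≡ᵇ z)} y (y<pair x y)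
                      (any<-intro z x (x<pair x y) (≡ᵇ-refl z)))
    in proj₂ (pair-injective {j} {snd z} {x} {y} (≡ᵇ-elim (pair j (snd z)) z q))

  snd-≤ : ∀ z → snd z ≤ pred z
  snd-≤ z = find-≤ z _

  fst-0 : fst 0 ≡ 0
  fst-0 = n≤0⇒n≡0 (find-≤ 0 _)

rec : ∀ {A : Set} → A → (ℕ → A → A) → ℕ → A
rec a f zero = a
rec a f (suc n) = f n (rec a f n)

drop : ℕ → ℕ → ℕ
drop i d = rec d (λ _ → snd) i

nth : ℕ → ℕ → ℕ
nth d i = fst (drop i d)

drop-suc : ∀ i d → drop (suc i) d ≡ drop i (snd d)
drop-suc zero d = refl
drop-suc (suc i) d = cong snd (drop-suc i d)

drop-drop : ∀ i j d → drop i (drop j d) ≡ drop (i + j) d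
drop-drop zero j d = refl
drop-drop (suc i) j d = cong snd (drop-drop i j d)

nth-drop : ∀ i j d → nth (drop j d) i ≡ nth d (i + j)
nth-drop i j d = cong fst (drop-drop i j d)

nth-zero-pair : ∀ x d → nth (pair x d) 0 ≡ x
nth-zero-pair = fst-pair

nth-suc-pair : ∀ x d i → nth (pair x d) (suc i) ≡ nth d i
nth-suc-pair x d i = cong fst (trans (drop-suc i (pair x d)) (cong (drop i) (snd-pair x d)))

drop-≤ : ∀ i d → drop i d ≤ d ∸ i
drop-≤ zero d = ≤-refl
drop-≤ (suc i) d = begin
  snd (drop i d)  ≤⟨ snd-≤ (drop i d) ⟩
  pred (drop i d) ≤⟨ pred-mono-≤ (drop-≤ i d) ⟩
  pred (d ∸ i)    ≡⟨ pred[m∸n]≡m∸[1+n] d i ⟩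
  d ∸ suc i       ∎
  where open ≤-Reasoning

drop-≥ : ∀ {i d} → d ≤ i → drop i d ≡ 0
drop-≥ {i} {d} d≤i = n≤0⇒n≡0 (subst (drop i d ≤_) (m≤n⇒m∸n≡0 d≤i) (drop-≤ i d))

-- Each `drop` lowers the code until it is 0. So the code of a list bounds the positions of its
-- nonzero entries, and `any< d` searches the whole list without a length function.
nth-nonzero : ∀ {i d} → ¬ nth d i ≡ 0 → i < d
nth-nonzero {i} {d} nz with i <? d
... | yes i<d = i<d
... | no i≮d = contradiction (trans (cong fst (drop-≥ (≮⇒≥ i≮d))) fst-0) nz

-- Computable functions

record Computable (X : SetOfNat) {k : ℕ} (f : Vec ℕ k → ℕ) : Set where
  constructor computable
  field
    program  : PR k
    computes : ∀ v → Eval X program v (f v)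
open Computable

record Decidable (X : SetOfNat) {k : ℕ} (R : Vec ℕ k → Bool) : Set where
  constructor decidable
  field characteristic : Computable X (λ v → b2n (R v))
open Decidable

computable-≗ : ∀ {X k} {f g : Vec ℕ k → ℕ} → (∀ v → f v ≡ g v) → Computable X f → Computable X g
computable-≗ {X} f≗g (computable p e) =
  computable p λ v → subst (Eval X p v) (f≗g v) (e v)

module _ {X : SetOfNat} where

  compose : ∀ {k m} {f : Vec ℕ m → ℕ} (g : Fin m → Vec ℕ k → ℕ) → Computable X f →
            (∀ i → Computable X (g i)) → Computable X (λ v → f (tabulate (λ i → g i v)))
  compose g cf cg = computable
    (comp (program cf) (λ i → program (cg i)))
    (λ v → e-comp (λ i → computes (cg i) v) (computes cf (tabulate (λ i → g i v))))

  projᶜ : ∀ {k} (i : Fin k) → Computable X (λ v → lookup v i)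
  projᶜ i = computable (proj i) λ v → e-proj

  varᶜ : ∀ {k} → Computable X {suc k} head
  varᶜ = computable-≗ (λ { (x ∷ v) → refl }) (projᶜ zero)

  wkᶜ : ∀ {k} {f : Vec ℕ k → ℕ} → Computable X f → Computable X (λ (v : Vec ℕ (suc k)) → f (tail v))
  wkᶜ {f = f} cf = computable-≗ (λ { (x ∷ v) → cong f (tabulate∘lookup v) })
    (compose (λ i v → lookup v (suc i)) cf (λ i → projᶜ (suc i)))

  sucᶜ : ∀ {k} {f : Vec ℕ k → ℕ} → Computable X f → Computable X (λ v → suc (f v))
  sucᶜ {f = f} cf = computable (comp succ (λ _ → program cf))
    (λ v → e-comp {ys = λ _ → f v} (λ _ → computes cf v) e-succ)

  constᶜ : ∀ {k} n → Computable X {k} (λ _ → n)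
  constᶜ zero = computable zer λ v → e-zer
  constᶜ (suc n) = sucᶜ (constᶜ n)

  oracleᶜ : ∀ {k} {f : Vec ℕ k → ℕ} → Computable X f → Decidable X (λ v → X (f v))
  oracleᶜ {f = f} cf = decidable (computable (comp orc (λ _ → program cf))
    (λ v → e-comp {ys = λ _ → f v} (λ _ → computes cf v) e-orc))

  recᶜ : ∀ {k} {n : Vec ℕ k → ℕ} {g : Vec ℕ k → ℕ} {h : Vec ℕ (suc (suc k)) → ℕ} →
         Computable X n → Computable X g → Computable X h →
         Computable X (λ v → rec (g v) (λ i z → h (i ∷ z ∷ v)) (n v))
  recᶜ {k} {n} {g} {h} cn cg ch =
    computable-≗ (λ v → cong (λ u → rec (g u) (λ i z → h (i ∷ z ∷ u)) (n v)) (tabulate∘lookup v))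
      (compose args (computable (prec (program cg) (program ch)) run) args-computable)
    where
    args : Fin (suc k) → Vec ℕ k → ℕ
    args zero v = n v
    args (suc i) v = lookup v i
    args-computable : ∀ i → Computable X (args i)
    args-computable zero = cn
    args-computable (suc i) = projᶜ i
    run′ : ∀ m v → Eval X (prec (program cg) (program ch)) (m ∷ v) (rec (g v) (λ i z → h (i ∷ z ∷ v)) m)
    run′ zero v = e-prec0 (computes cg v)
    run′ (suc m) v = e-precS (run′ m v) (computes ch _)
    run : ∀ v → Eval X (prec (program cg) (program ch)) v
                  (rec (g (tail v)) (λ i z → h (i ∷ z ∷ tail v)) (head v))
    run (m ∷ v) = run′ m v

  predᶜ : ∀ {k} {f : Vec ℕ k → ℕ} → Computable X f → Computable X (λ v → pred (f v))
  predᶜ {f = f} cf = computable-≗ (λ v → lemma (f v)) (recᶜ cf (constᶜ 0) varᶜ)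
    where
    lemma : ∀ n → rec 0 (λ i _ → i) n ≡ pred n
    lemma zero = refl
    lemma (suc n) = refl

  infixl 6 _+ᶜ_ _∸ᶜ_
  infixl 7 _*ᶜ_

  _+ᶜ_ : ∀ {k} {f g : Vec ℕ k → ℕ} → Computable X f → Computable X g → Computable X (λ v → f v + g v)
  _+ᶜ_ {f = f} {g} cf cg = computable-≗ (λ v → lemma (f v) (g v)) (recᶜ cf cg (sucᶜ (wkᶜ varᶜ)))
    where
    lemma : ∀ m n → rec n (λ _ → suc) m ≡ m + n
    lemma zero n = refl
    lemma (suc m) n = cong suc (lemma m n)

  _*ᶜ_ : ∀ {k} {f g : Vec ℕ k → ℕ} → Computable X f → Computable X g → Computable X (λ v → f v * g v)
  _*ᶜ_ {f = f} {g} cf cg = computable-≗ (λ v → lemma (f v) (g v))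
    (recᶜ cf (constᶜ 0) (wkᶜ (wkᶜ cg) +ᶜ wkᶜ varᶜ))
    where
    lemma : ∀ m n → rec 0 (λ _ z → n + z) m ≡ m * n
    lemma zero n = refl
    lemma (suc m) n = cong (n +_) (lemma m n)

  _∸ᶜ_ : ∀ {k} {f g : Vec ℕ k → ℕ} → Computable X f → Computable X g → Computable X (λ v → f v ∸ g v)
  _∸ᶜ_ {f = f} {g} cf cg = computable-≗ (λ v → lemma (f v) (g v)) (recᶜ cg cf (predᶜ (wkᶜ varᶜ)))
    where
    lemma : ∀ m n → rec m (λ _ → pred) n ≡ m ∸ n
    lemma m zero = refl
    lemma m (suc n) = trans (cong pred (lemma m n)) (pred[m∸n]≡m∸[1+n] m n)

  2^ᶜ : ∀ {k} {f : Vec ℕ k → ℕ} → Computable X f → Computable X (λ v → 2 ^ f v)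
  2^ᶜ {f = f} cf = computable-≗ (λ v → lemma (f v)) (recᶜ cf (constᶜ 1) (constᶜ 2 *ᶜ wkᶜ varᶜ))
    where
    lemma : ∀ n → rec 1 (λ _ z → 2 * z) n ≡ 2 ^ n
    lemma zero = refl
    lemma (suc n) = cong (2 *_) (lemma n)

  decidable-≗ : ∀ {k} {f : Vec ℕ k → ℕ} {R : Vec ℕ k → Bool} → (∀ v → f v ≡ b2n (R v)) →
                Computable X f → Decidable X R
  decidable-≗ f≗R cf = decidable (computable-≗ f≗R cf)

  notᵈ : ∀ {k} {R : Vec ℕ k → Bool} → Decidable X R → Decidable X (λ v → not (R v))
  notᵈ {R = R} dR = decidable-≗ (λ v → lemma (R v)) (constᶜ 1 ∸ᶜ characteristic dR)
    where
    lemma : ∀ a → 1 ∸ b2n a ≡ b2n (not a)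
    lemma true = refl
    lemma false = refl

  ifᶜ : ∀ {k} {R : Vec ℕ k → Bool} {f g : Vec ℕ k → ℕ} → Decidable X R → Computable X f →
        Computable X g → Computable X (λ v → if R v then f v else g v)
  ifᶜ {R = R} {f} {g} dR cf cg = computable-≗ (λ v → lemma (R v) (f v) (g v))
    (characteristic dR *ᶜ cf +ᶜ characteristic (notᵈ dR) *ᶜ cg)
    where
    lemma : ∀ a m n → b2n a * m + b2n (not a) * n ≡ (if a then m else n)
    lemma true m n = trans (+-identityʳ _) (*-identityˡ m)
    lemma false m n = *-identityˡ n

  ifᵈ : ∀ {k} {R S T : Vec ℕ k → Bool} → Decidable X R → Decidable X S →
        Decidable X T → Decidable X (λ v → if R v then S v else T v)
  ifᵈ {R = R} {S} {T} dR dS dT = decidable-≗ (λ v → lemma (R v) (S v) (T v))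
    (ifᶜ dR (characteristic dS) (characteristic dT))
    where
    lemma : ∀ a b c → (if a then b2n b else b2n c) ≡ b2n (if a then b else c)
    lemma true b c = refl
    lemma false b c = refl

  infixr 6 _∧ᵈ_
  infixr 5 _∨ᵈ_
  infix 4 _≡ᵈ_ _<ᵈ_

  _∧ᵈ_ : ∀ {k} {R S : Vec ℕ k → Bool} → Decidable X R → Decidable X S → Decidable X (λ v → R v ∧ S v)
  _∧ᵈ_ {R = R} {S} dR dS = decidable-≗ (λ v → lemma (R v) (S v)) (characteristic dR *ᶜ characteristic dS)
    where
    lemma : ∀ a b → b2n a * b2n b ≡ b2n (a ∧ b)
    lemma true b = *-identityˡ (b2n b)
    lemma false b = refl

  _∨ᵈ_ : ∀ {k} {R S : Vec ℕ k → Bool} → Decidable X R → Decidable X S → Decidable X (λ v → R v ∨ S v)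
  _∨ᵈ_ {R = R} {S} dR dS = decidable-≗ (λ v → lemma (R v) (S v)) (ifᶜ dR (constᶜ 1) (characteristic dS))
    where
    lemma : ∀ a b → (if a then 1 else b2n b) ≡ b2n (a ∨ b)
    lemma true b = refl
    lemma false b = refl

  _<ᵈ_ : ∀ {k} {f g : Vec ℕ k → ℕ} → Computable X f → Computable X g → Decidable X (λ v → f v <ᵇ g v)
  _<ᵈ_ {f = f} {g} cf cg = decidable-≗ (λ v → lemma (f v) (g v)) (constᶜ 1 ∸ᶜ (sucᶜ cf ∸ᶜ cg))
    where
    lemma : ∀ m n → 1 ∸ (suc m ∸ n) ≡ b2n (m <ᵇ n)
    lemma m zero = 0∸n≡0 m
    lemma zero (suc n) = cong (1 ∸_) (0∸n≡0 n)
    lemma (suc m) (suc n) = lemma m n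

  _≡ᵈ_ : ∀ {k} {f g : Vec ℕ k → ℕ} → Computable X f → Computable X g → Decidable X (λ v → f v ≡ᵇ g v)
  _≡ᵈ_ {f = f} {g} cf cg = decidable-≗ (λ v → lemma (f v) (g v)) (constᶜ 1 ∸ᶜ ((cf ∸ᶜ cg) +ᶜ (cg ∸ᶜ cf)))
    where
    lemma : ∀ m n → 1 ∸ ((m ∸ n) + (n ∸ m)) ≡ b2n (m ≡ᵇ n)
    lemma zero zero = refl
    lemma zero (suc n) = 0∸n≡0 n
    lemma (suc m) zero = 0∸n≡0 (m + 0)
    lemma (suc m) (suc n) = lemma m n

  updateᶜ : ∀ {k} {f g : Vec ℕ (suc k) → ℕ} → Computable X g → Computable X f →
            Computable X (λ v → f (g v ∷ tail v))
  updateᶜ {k} {f} {g} cg cf = computable-≗ (λ { (x ∷ v) → cong (λ u → f (g (x ∷ v) ∷ u)) (tabulate∘lookup v) })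
    (compose args cf args-computable)
    where
    args : Fin (suc k) → Vec ℕ (suc k) → ℕ
    args zero v = g v
    args (suc i) v = lookup v (suc i)
    args-computable : ∀ i → Computable X (args i)
    args-computable zero = cg
    args-computable (suc i) = projᶜ (suc i)

  -- In a step of `recᶜ` the dropped coordinate is the accumulator; in the matrix of a formula it is
  -- a variable that is vacuous or already absorbed into the first coordinate.
  skipᶜ : ∀ {k} {f : Vec ℕ (suc k) → ℕ} → Computable X f →
          Computable X (λ (v : Vec ℕ (suc (suc k))) → f (head v ∷ tail (tail v)))
  skipᶜ {k} {f} cf = computable-≗ (λ { (x ∷ y ∷ v) → cong (λ u → f (x ∷ u)) (tabulate∘lookup v) })
    (compose args cf args-computable)
    where
    args : Fin (suc k) → Vec ℕ (suc (suc k)) → ℕ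
    args zero v = head v
    args (suc i) v = lookup v (suc (suc i))
    args-computable : ∀ i → Computable X (args i)
    args-computable zero = varᶜ
    args-computable (suc i) = projᶜ (suc (suc i))

  opaque
    unfolding any< all< find

    any<ᵈ : ∀ {k} {n : Vec ℕ k → ℕ} {R : Vec ℕ (suc k) → Bool} → Computable X n → Decidable X R →
            Decidable X (λ v → any< (n v) (λ i → R (i ∷ v)))
    any<ᵈ {n = n} {R} cn dR = decidable-≗ (λ v → lemma (λ i → R (i ∷ v)) (n v))
      (recᶜ cn (constᶜ 0) (ifᶜ {R = λ v → R (head v ∷ tail (tail v))}
        (decidable (skipᶜ (characteristic dR))) (constᶜ 1) (wkᶜ varᶜ)))
      where
      lemma : ∀ f m → rec 0 (λ i z → if f i then 1 else z) m ≡ b2n (any< m f)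
      lemma f zero = refl
      lemma f (suc m) with f m
      ... | true = refl
      ... | false = lemma f m

    all<ᵈ : ∀ {k} {n : Vec ℕ k → ℕ} {R : Vec ℕ (suc k) → Bool} → Computable X n → Decidable X R →
            Decidable X (λ v → all< (n v) (λ i → R (i ∷ v)))
    all<ᵈ cn dR = notᵈ (any<ᵈ cn (notᵈ dR))

    findᶜ : ∀ {k} {n : Vec ℕ k → ℕ} {R : Vec ℕ (suc k) → Bool} → Computable X n → Decidable X R →
            Computable X (λ v → find (n v) (λ i → R (i ∷ v)))
    findᶜ {n = n} {R} cn dR = computable-≗ (λ v → lemma (λ i → R (i ∷ v)) (n v))
      (recᶜ cn (constᶜ 0) (ifᶜ {R = λ v → R (head v ∷ tail (tail v))}
        (decidable (skipᶜ (characteristic dR))) varᶜ (wkᶜ varᶜ)))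
      where
      lemma : ∀ f m → rec 0 (λ i z → if f i then i else z) m ≡ find m f
      lemma f zero = refl
      lemma f (suc m) with f m
      ... | true = refl
      ... | false = lemma f m

  opaque
    unfolding pair

    pairᶜ : ∀ {k} {f g : Vec ℕ k → ℕ} → Computable X f → Computable X g → Computable X (λ v → pair (f v) (g v))
    pairᶜ cf cg = sucᶜ ((cf +ᶜ cg) *ᶜ (cf +ᶜ cg) +ᶜ cf)

    fstᶜ : ∀ {k} {f : Vec ℕ k → ℕ} → Computable X f → Computable X (λ v → fst (f v))
    fstᶜ cf = findᶜ cf (any<ᵈ (wkᶜ cf) (pairᶜ (wkᶜ varᶜ) varᶜ ≡ᵈ wkᶜ (wkᶜ cf)))

    sndᶜ : ∀ {k} {f : Vec ℕ k → ℕ} → Computable X f → Computable X (λ v → snd (f v))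
    sndᶜ cf = findᶜ cf (any<ᵈ (wkᶜ cf) (pairᶜ varᶜ (wkᶜ varᶜ) ≡ᵈ wkᶜ (wkᶜ cf)))

  dropᶜ : ∀ {k} {f g : Vec ℕ k → ℕ} → Computable X f → Computable X g → Computable X (λ v → drop (f v) (g v))
  dropᶜ cf cg = recᶜ cf cg (sndᶜ (wkᶜ varᶜ))

  nthᶜ : ∀ {k} {f g : Vec ℕ k → ℕ} → Computable X f → Computable X g → Computable X (λ v → nth (f v) (g v))
  nthᶜ cf cg = fstᶜ (dropᶜ cg cf)

-- Coded derivations of the evaluation relation

encodeVec : ∀ {k} → Vec ℕ k → ℕ
encodeVec [] = 0
encodeVec (x ∷ v) = pair x (encodeVec v)

decodeVec : ∀ k → ℕ → Vec ℕ k
decodeVec k w = tabulate {n = k} (λ i → nth w (toℕ i))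

nth-encodeVec : ∀ {k} (v : Vec ℕ k) i → nth (encodeVec v) (toℕ i) ≡ lookup v i
nth-encodeVec (x ∷ v) zero = nth-zero-pair x (encodeVec v)
nth-encodeVec (x ∷ v) (suc i) = trans (nth-suc-pair x (encodeVec v) (toℕ i)) (nth-encodeVec v i)

decodeVec-encodeVec : ∀ {k} (v : Vec ℕ k) → decodeVec k (encodeVec v) ≡ v
decodeVec-encodeVec v = trans (tabulate-cong (nth-encodeVec v)) (tabulate∘lookup v)

decodeVec-suc : ∀ k w → decodeVec (suc k) w ≡ fst w ∷ decodeVec k (snd w)
decodeVec-suc k w = cong (fst w ∷_) (tabulate-cong {n = k} (λ i → cong fst (drop-suc (toℕ i) w)))

decodeVec-pair : ∀ k x w → decodeVec (suc k) (pair x w) ≡ x ∷ decodeVec k w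
decodeVec-pair k x w =
  trans (decodeVec-suc k (pair x w)) (cong₂ (λ y u → y ∷ decodeVec k u) (fst-pair x w) (snd-pair x w))

codePR : ∀ {k} → PR k → ℕ
codePR zer = pair 0 0
codePR succ = pair 1 0
codePR (proj i) = pair 2 (toℕ i)
codePR orc = pair 3 0
codePR (comp {m = m} f gs) = pair 4 (pair (codePR f) (pair m (encodeVec (tabulate (λ j → codePR (gs j))))))
codePR (prec g h) = pair 5 (pair (codePR g) (codePR h))
codePR (mu f) = pair 6 (codePR f)

judgement : ℕ → ℕ → ℕ → ℕ
judgement c w z = pair c (pair w z)

-- A derivation is a coded list of entries pair J a: the judgement J follows from judgements
-- further down the list, and a carries the intermediate values used by the rule.
opaque
  derives : ℕ → ℕ → Bool
  derives d J = any< d (λ i → fst (nth d i) ≡ᵇ J)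

-- q x z decides whether z is accepted as the oracle's answer to x.
rule : (ℕ → ℕ → Bool) → (tag c b w z a d : ℕ) → Bool
rule q 0 c b w z a d = z ≡ᵇ 0
rule q 1 c b w z a d = z ≡ᵇ suc (fst w)
rule q 2 c b w z a d = z ≡ᵇ nth w b
rule q 3 c b w z a d = q (fst w) z
rule q 4 c b w z a d =
  all< (fst (snd b)) (λ j → derives d (judgement (nth (snd (snd b)) j) w (nth a j))) ∧
  derives d (judgement (fst b) a z)
rule q 5 c b w z a d =
  if fst w ≡ᵇ 0 then derives d (judgement (fst b) (snd w) z)
  -- The recursive call is to the same program, which is why `rule` receives the full code `c`
  -- besides its body `b`; `a` is the value of that call.
  else (derives d (judgement c (pair (pred (fst w)) (snd w)) a) ∧
        derives d (judgement (snd b) (pair (pred (fst w)) (pair a (snd w))) z))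
-- Here `a` lists the predecessors of the values at arguments below z, so `suc` certifies that these
-- values are nonzero.
rule q 6 c b w z a d =
  derives d (judgement b (pair z w) 0) ∧
  all< z (λ i → derives d (judgement b (pair i w) (suc (nth a i))))
rule q (suc (suc (suc (suc (suc (suc (suc _))))))) c b w z a d = false

justified : (ℕ → ℕ → Bool) → ℕ → ℕ → Bool
justified q e d =
  rule q (fst (fst (fst e))) (fst (fst e)) (snd (fst (fst e)))
    (fst (snd (fst e))) (snd (snd (fst e))) (snd e) d

-- The bound d overshoots the length of the list, and positions past the end read 0, hence the
-- exemption of zero entries. It is harmless: the first component of 0 is 0, which is no judgement.
isDerivation : (ℕ → ℕ → Bool) → ℕ → Bool
isDerivation q d = all< d (λ i → (nth d i ≡ᵇ 0) ∨ justified q (nth d i) (drop (suc i) d))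

-- Oracle answers and premises occur only positively in `rule`, so it survives a more generous
-- oracle as well as a longer list. The restriction to `pair x y` leaves out the number 0, which
-- padding entries would match.
rule-mono : ∀ {q q′ : ℕ → ℕ → Bool} {d d′} → (∀ x z → q x z ≡ true → q′ x z ≡ true) →
            (∀ x y → derives d (pair x y) ≡ true → derives d′ (pair x y) ≡ true) →
            ∀ tag c b w z a → rule q tag c b w z a d ≡ true → rule q′ tag c b w z a d′ ≡ true
rule-mono hq hd 0 c b w z a p = p
rule-mono hq hd 1 c b w z a p = p
rule-mono hq hd 2 c b w z a p = p
rule-mono hq hd 3 c b w z a p = hq _ _ p
rule-mono hq hd 4 c b w z a p =
  let r , s = ∧-elim p
  in ∧-intro (all<-intro _ λ j j< → hd _ _ (all<-elim _ r j j<)) (hd _ _ s)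
rule-mono hq hd 5 c b w z a p with fst w ≡ᵇ 0
... | true = hd _ _ p
... | false = let r , s = ∧-elim p in ∧-intro (hd _ _ r) (hd _ _ s)
rule-mono hq hd 6 c b w z a p =
  let r , s = ∧-elim p
  in ∧-intro (hd _ _ r) (all<-intro _ λ j j< → hd _ _ (all<-elim _ s j j<))
rule-mono hq hd (suc (suc (suc (suc (suc (suc (suc _))))))) c b w z a ()

justified-judgement : ∀ q {e t b w z} d → fst e ≡ judgement (pair t b) w z →
  justified q e d ≡ rule q t (pair t b) b w z (snd e) d
justified-judgement q {e} {t} {b} {w} {z} d eq
  rewrite eq | fst-pair (pair t b) (pair w z) | snd-pair (pair t b) (pair w z)
        | fst-pair t b | snd-pair t b | fst-pair w z | snd-pair w z = refl

justified-mono : ∀ {q q′ : ℕ → ℕ → Bool} {d d′} → (∀ x z → q x z ≡ true → q′ x z ≡ true) →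
                 (∀ x y → derives d (pair x y) ≡ true → derives d′ (pair x y) ≡ true) →
                 ∀ e → justified q e d ≡ true → justified q′ e d′ ≡ true
justified-mono hq hd e =
  rule-mono hq hd (fst (fst (fst e))) (fst (fst e)) (snd (fst (fst e)))
    (fst (snd (fst e))) (snd (snd (fst e))) (snd e)

isDerivation-mono : ∀ {q q′ : ℕ → ℕ → Bool} → (∀ x z → q x z ≡ true → q′ x z ≡ true) →
  ∀ d → isDerivation q d ≡ true → isDerivation q′ d ≡ true
isDerivation-mono {q} {q′} hq d p = all<-intro d λ i i<d → step i (∨-elim {nth d i ≡ᵇ 0} (all<-elim d p i i<d))
  where
  step : ∀ i → (nth d i ≡ᵇ 0) ≡ true ⊎ justified q (nth d i) (drop (suc i) d) ≡ true →
         (nth d i ≡ᵇ 0) ∨ justified q′ (nth d i) (drop (suc i) d) ≡ true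
  step i (inj₁ r) = ∨-introˡ r
  step i (inj₂ r) = ∨-introʳ {nth d i ≡ᵇ 0} (justified-mono hq (λ _ _ s → s) (nth d i) r)

opaque
  unfolding derives

  derives-elim : ∀ d J → derives d J ≡ true → Σ ℕ λ i → i < d × fst (nth d i) ≡ J
  derives-elim d J p = let i , i<d , q = any<-elim d p in i , i<d , ≡ᵇ-elim _ J q

  derives-intro : ∀ d x y i → fst (nth d i) ≡ pair x y → derives d (pair x y) ≡ true
  derives-intro d x y i eq =
    any<-intro d i (nth-nonzero λ nz → pair≢0 (trans (sym eq) (trans (cong fst nz) fst-0))) (≡ᵇ-intro eq)

-- Soundness

-- Entries are justified by later entries only, so a suffix stands on its own.
isDerivation-drop : ∀ q d j → isDerivation q d ≡ true → isDerivation q (drop j d) ≡ true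
isDerivation-drop q d j p = all<-intro (drop j d) step
  where
  step : ∀ i → i < drop j d →
         (nth (drop j d) i ≡ᵇ 0) ∨ justified q (nth (drop j d) i) (drop (suc i) (drop j d)) ≡ true
  step i i< rewrite nth-drop i j d | drop-drop (suc i) j d =
    all<-elim d p (i + j) (<-≤-trans (+-monoˡ-< j i<) bound)
    where
    bound : drop j d + j ≤ d
    bound with j ≤? d
    ... | yes j≤d = ≤-trans (+-monoˡ-≤ j (drop-≤ j d)) (≤-reflexive (m∸n+n≡m j≤d))
    ... | no j≰d = contradiction (subst (i <_) (drop-≥ (<⇒≤ (≰⇒> j≰d))) i<) λ ()

module Soundness {X : SetOfNat} {q : ℕ → ℕ → Bool} (q-sound : ∀ x z → q x z ≡ true → z ≡ b2n (X x)) where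

  -- Since `pair` is opaque, the tag is recovered from `codePR c ≡ pair t b` by injectivity, after
  -- which `rule` reduces. A derivation may mention any number w as an argument tuple, so w is read
  -- by the total `decodeVec`.
  rule-sound : ∀ d →
    (∀ {k} (c : PR k) w z → derives d (judgement (codePR c) w z) ≡ true → Eval X c (decodeVec k w) z) →
    ∀ {k} (c : PR k) w z a → ∀ t b → codePR c ≡ pair t b →
    rule q t (pair t b) b w z a d ≡ true → Eval X c (decodeVec k w) z
  rule-sound d IH zer w z a t b eq p with refl , refl ← pair-injective eq with refl ← ≡ᵇ-elim z 0 p = e-zer
  rule-sound d IH succ w z a t b eq p
    with refl , refl ← pair-injective eq with refl ← ≡ᵇ-elim z (suc (fst w)) p = e-succ
  rule-sound d IH (proj {k} i) w z a t b eq p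
    with refl , refl ← pair-injective eq with refl ← ≡ᵇ-elim z (nth w (toℕ i)) p =
    subst (Eval X (proj i) (decodeVec k w)) (lookup∘tabulate (λ i → nth w (toℕ i)) i) e-proj
  rule-sound d IH orc w z a t b eq p
    with refl , refl ← pair-injective eq with refl ← q-sound (fst w) z p = e-orc
  rule-sound d IH (comp {m = m} f gs) w z a t b eq p
    with refl , refl ← pair-injective eq =
    e-comp {ys = λ j → nth a (toℕ j)}
      (λ j → IH (gs j) w _
        (subst (λ c → derives d (judgement c w (nth a (toℕ j))) ≡ true)
          (trans (cong (λ u → nth u (toℕ j)) gs≡)
            (trans (nth-encodeVec (tabulate (λ j → codePR (gs j))) j) (lookup∘tabulate (λ j → codePR (gs j)) j)))
          (all<-elim _ (proj₁ (∧-elim p)) (toℕ j) (subst (toℕ j <_) (sym m≡) (toℕ<n j)))))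
      (IH f a z (subst (λ c → derives d (judgement c a z) ≡ true) (fst-pair _ _) (proj₂ (∧-elim p))))
    where
    codes : ℕ
    codes = encodeVec (tabulate (λ j → codePR (gs j)))
    args : ℕ
    args = pair (codePR f) (pair m codes)
    m≡ : fst (snd args) ≡ m
    m≡ = trans (cong fst (snd-pair _ _)) (fst-pair _ _)
    gs≡ : snd (snd args) ≡ codes
    gs≡ = trans (cong snd (snd-pair _ _)) (snd-pair _ _)
  rule-sound d IH (prec {k} g h) w z a t b eq p
    with refl , refl ← pair-injective eq
    rewrite decodeVec-suc k w | fst-pair (codePR g) (codePR h) | snd-pair (codePR g) (codePR h)
    with fst w
  ... | zero = e-prec0 (IH g (snd w) z p)
  ... | suc n = e-precS
    (subst (λ v → Eval X (prec g h) v a) (decodeVec-pair k n (snd w)) (IH (prec g h) _ a (proj₁ (∧-elim p))))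
    (subst (λ v → Eval X h v z)
      (trans (decodeVec-pair (suc k) n _) (cong (n ∷_) (decodeVec-pair k a (snd w))))
      (IH h _ z (proj₂ (∧-elim p))))
  rule-sound d IH (mu {k} f) w z a t b eq p
    with refl , refl ← pair-injective eq =
    e-mu (subst (λ v → Eval X f v 0) (decodeVec-pair k z w) (IH f _ 0 (proj₁ (∧-elim p))))
      (λ i i<z → nth a i , subst (λ v → Eval X f v (suc (nth a i))) (decodeVec-pair k i w)
        (IH f _ _ (all<-elim z (proj₂ (∧-elim p)) i i<z)))

  codePR-pair : ∀ {k} (c : PR k) → Σ ℕ λ t → Σ ℕ λ b → codePR c ≡ pair t b
  codePR-pair zer = _ , _ , refl
  codePR-pair succ = _ , _ , refl
  codePR-pair (proj i) = _ , _ , refl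
  codePR-pair orc = _ , _ , refl
  codePR-pair (comp f gs) = _ , _ , refl
  codePR-pair (prec g h) = _ , _ , refl
  codePR-pair (mu f) = _ , _ , refl

  -- Induction on a bound N for the code: the suffix behind the entry that concludes the judgement
  -- has a strictly smaller code and contains all its premises.
  derivation-sound : ∀ N d → d ≤ N → isDerivation q d ≡ true →
    ∀ {k} (c : PR k) w z → derives d (judgement (codePR c) w z) ≡ true → Eval X c (decodeVec k w) z
  derivation-sound N d d≤N der {k} c w z p with derives-elim d _ p
  derivation-sound zero d d≤0 der c w z p | i , i<d , eq = contradiction (<-≤-trans i<d d≤0) λ ()
  derivation-sound (suc N) d d≤N der c w z p | i , i<d , eq
    with t , b , c≡ ← codePR-pair c =
    rule-sound d′ (derivation-sound N d′ d′≤N (isDerivation-drop q d (suc i) der)) c w z (snd (nth d i)) t b c≡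
      (trans (sym (justified-judgement q d′ eq′)) (nonzero (∨-elim (all<-elim d der i i<d))))
    where
    d′ : ℕ
    d′ = drop (suc i) d
    d′≤N : d′ ≤ N
    d′≤N = ≤-trans (drop-≤ (suc i) d) (≤-trans (∸-monoˡ-≤ (suc i) d≤N) (m∸n≤m N i))
    eq′ : fst (nth d i) ≡ judgement (pair t b) w z
    eq′ = trans eq (cong (λ c → judgement c w z) c≡)
    nonzero : (nth d i ≡ᵇ 0) ≡ true ⊎ justified q (nth d i) d′ ≡ true → justified q (nth d i) d′ ≡ true
    nonzero (inj₁ r) = contradiction (trans (sym eq) (trans (cong fst (≡ᵇ-elim _ 0 r)) fst-0)) pair≢0
    nonzero (inj₂ r) = r

-- Completeness

encodeList : List ℕ → ℕ
encodeList [] = 0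
encodeList (e ∷ l) = pair e (encodeList l)

Concludes : ℕ → List ℕ → Set
Concludes J = Any (λ e → fst e ≡ J)

concludes-derives : ∀ {l x y} → Concludes (pair x y) l → derives (encodeList l) (pair x y) ≡ true
concludes-derives {l} {x} {y} h = let i , eq = position h in derives-intro (encodeList l) x y i eq
  where
  position : ∀ {l} → Concludes (pair x y) l → Σ ℕ λ i → fst (nth (encodeList l) i) ≡ pair x y
  position {e ∷ l} (here eq) = 0 , trans (cong fst (nth-zero-pair e (encodeList l))) eq
  position {e ∷ l} (there h) with i , eq ← position h =
    suc i , trans (cong fst (nth-suc-pair e (encodeList l) i)) eq

nth-0 : ∀ i → nth 0 i ≡ 0
nth-0 i = trans (cong fst (drop-≥ {i} z≤n)) fst-0

derives-concludes : ∀ l {x y} → derives (encodeList l) (pair x y) ≡ true → Concludes (pair x y) l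
derives-concludes l {x} {y} p = let i , _ , eq = derives-elim (encodeList l) _ p in go l i eq
  where
  go : ∀ l i → fst (nth (encodeList l) i) ≡ pair x y → Concludes (pair x y) l
  go [] i eq = contradiction (trans (sym eq) (trans (cong fst (nth-0 i)) fst-0)) pair≢0
  go (e ∷ l) zero eq = here (trans (sym (cong fst (nth-zero-pair e (encodeList l)))) eq)
  go (e ∷ l) (suc i) eq = there (go l i (trans (sym (cong fst (nth-suc-pair e (encodeList l) i))) eq))

data Derivation (q : ℕ → ℕ → Bool) : List ℕ → Set where
  []  : Derivation q []
  _∷_ : ∀ {e l} → justified q e (encodeList l) ≡ true → Derivation q l → Derivation q (e ∷ l)

-- Entries of the front list merely see a longer remainder, and justification is monotone in it.
-- This lets the derivations of several premises be merged into one list.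
_++ᵈ_ : ∀ {q l l′} → Derivation q l → Derivation q l′ → Derivation q (l ++ l′)
[] ++ᵈ D′ = D′
_++ᵈ_ {l = e ∷ l} (p ∷ D) D′ =
  justified-mono (λ _ _ r → r) (λ _ _ r → concludes-derives (++⁺ˡ (derives-concludes l r))) e p ∷ (D ++ᵈ D′)

derivation-mono : ∀ {q q′ : ℕ → ℕ → Bool} {l} → (∀ x z → q x z ≡ true → q′ x z ≡ true) →
  Derivation q l → Derivation q′ l
derivation-mono hq [] = []
derivation-mono hq (_∷_ {e} p D) = justified-mono hq (λ _ _ r → r) e p ∷ derivation-mono hq D

isDerivation-encodeList : ∀ {q l} → Derivation q l → isDerivation q (encodeList l) ≡ true
isDerivation-encodeList {q} {l} D = all<-intro (encodeList l) λ i _ → go D i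
  where
  go : ∀ {l} → Derivation q l → ∀ i →
       (nth (encodeList l) i ≡ᵇ 0) ∨ justified q (nth (encodeList l) i) (drop (suc i) (encodeList l)) ≡ true
  go [] i rewrite nth-0 i = refl
  go {e ∷ l} (p ∷ D) zero
    rewrite nth-zero-pair e (encodeList l) | snd-pair e (encodeList l) = ∨-introʳ {e ≡ᵇ 0} p
  go {e ∷ l} (p ∷ D) (suc i)
    rewrite nth-suc-pair e (encodeList l) i | drop-suc (suc i) (pair e (encodeList l))
          | snd-pair e (encodeList l) = go D i

Derivable : (ℕ → ℕ → Bool) → ℕ → Set
Derivable q J = Σ (List ℕ) λ l → Derivation q l × Concludes J l

derivable-all : ∀ {q} m (J : Fin m → ℕ) → (∀ i → Derivable q (J i)) →
  Σ (List ℕ) λ l → Derivation q l × (∀ i → Concludes (J i) l)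
derivable-all zero J h = [] , [] , λ ()
derivable-all (suc m) J h =
  let l , D , c = h zero
      l′ , D′ , c′ = derivable-all m (J ∘ suc) (h ∘ suc)
  in l ++ l′ , D ++ᵈ D′ , λ { zero → ++⁺ˡ c ; (suc i) → ++⁺ʳ l (c′ i) }

derivable : ∀ {q l} t b w z a → Derivation q l → rule q t (pair t b) b w z a (encodeList l) ≡ true →
  Derivable q (judgement (pair t b) w z)
derivable {q} {l} t b w z a D p =
  e ∷ l ,
  trans (justified-judgement q (encodeList l) (fst-pair J a))
    (trans (cong (λ a → rule q t (pair t b) b w z a (encodeList l)) (snd-pair J a)) p) ∷ D ,
  here (fst-pair J a)
  where
  J e : ℕ
  J = judgement (pair t b) w z
  e = pair J a

all<-Fin : ∀ n {f : ℕ → Bool} → (∀ (i : Fin n) → f (toℕ i) ≡ true) → all< n f ≡ true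
all<-Fin n {f} h = all<-intro n λ i i<n → subst (λ i → f i ≡ true) (toℕ-fromℕ< i<n) (h (fromℕ< i<n))

answers : SetOfNat → ℕ → ℕ → Bool
answers X x z = z ≡ᵇ b2n (X x)

eval-derivable : ∀ {X k} {c : PR k} {v z} → Eval X c v z →
  Derivable (answers X) (judgement (codePR c) (encodeVec v) z)
eval-derivable e-zer = derivable 0 0 _ 0 0 [] refl
eval-derivable (e-succ {x}) = derivable 1 0 _ _ 0 [] (≡ᵇ-intro (cong suc (sym (fst-pair x 0))))
eval-derivable (e-proj {i = i} {xs}) = derivable 2 (toℕ i) _ _ 0 [] (≡ᵇ-intro (sym (nth-encodeVec xs i)))
eval-derivable {X} (e-orc {x}) = derivable 3 0 _ _ 0 [] (≡ᵇ-intro (cong (λ x → b2n (X x)) (sym (fst-pair x 0))))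
eval-derivable {X} (e-comp {m = m} {f} {gs} {xs} {ys} {z} E F) =
  let l , D , c = derivable-all m _ (λ i → eval-derivable (E i))
      l′ , D′ , c′ = eval-derivable F
  in derivable 4 _ _ z a (D ++ᵈ D′) (∧-intro
       (subst
         (λ m → all< m (λ j → derives (encodeList (l ++ l′))
                               (judgement (nth (snd (snd args)) j) (encodeVec xs) (nth a j))) ≡ true)
         (sym m≡) (all<-Fin m λ i →
         trans (cong₂ (λ c y → derives (encodeList (l ++ l′)) (judgement c (encodeVec xs) y))
                 (trans (cong (λ u → nth u (toℕ i)) gs≡)
                   (trans (nth-encodeVec (tabulate (λ j → codePR (gs j))) i) (lookup∘tabulate (λ j → codePR (gs j)) i)))
                 (trans (nth-encodeVec (tabulate ys) i) (lookup∘tabulate ys i)))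
           (concludes-derives (++⁺ˡ (c i)))))
       (trans (cong (λ c → derives (encodeList (l ++ l′)) (judgement c a z)) (fst-pair _ _))
         (concludes-derives (++⁺ʳ l c′))))
  where
  a codes args : ℕ
  a = encodeVec (tabulate ys)
  codes = encodeVec (tabulate (λ j → codePR (gs j)))
  args = pair (codePR f) (pair m codes)
  m≡ : fst (snd args) ≡ m
  m≡ = trans (cong fst (snd-pair _ _)) (fst-pair _ _)
  gs≡ : snd (snd args) ≡ codes
  gs≡ = trans (cong snd (snd-pair _ _)) (snd-pair _ _)
eval-derivable {X} (e-prec0 {g = g} {h} {xs} {z} G) =
  let l , D , c = eval-derivable G
  in derivable 5 _ _ z 0 D (goal l (concludes-derives c))
  where
  goal : ∀ l → derives (encodeList l) (judgement (codePR g) (encodeVec xs) z) ≡ true →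
         rule (answers X) 5 (codePR (prec g h)) (pair (codePR g) (codePR h)) (pair 0 (encodeVec xs)) z 0
           (encodeList l) ≡ true
  goal l p rewrite fst-pair 0 (encodeVec xs) | snd-pair 0 (encodeVec xs) | fst-pair (codePR g) (codePR h) = p
eval-derivable {X} (e-precS {g = g} {h} {n} {xs} {z} {y} P H) =
  let l , D , c = eval-derivable P
      l′ , D′ , c′ = eval-derivable H
  in derivable 5 _ _ y z (D ++ᵈ D′)
       (goal (l ++ l′) (concludes-derives (++⁺ˡ c)) (concludes-derives (++⁺ʳ l c′)))
  where
  goal : ∀ l → derives (encodeList l) (judgement (codePR (prec g h)) (pair n (encodeVec xs)) z) ≡ true →
         derives (encodeList l) (judgement (codePR h) (pair n (pair z (encodeVec xs))) y) ≡ true →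
         rule (answers X) 5 (codePR (prec g h)) (pair (codePR g) (codePR h)) (pair (suc n) (encodeVec xs)) y z
           (encodeList l) ≡ true
  goal l p r
    rewrite fst-pair (suc n) (encodeVec xs) | snd-pair (suc n) (encodeVec xs)
          | snd-pair (codePR g) (codePR h) = ∧-intro p r
eval-derivable {X} (e-mu {f = f} {xs} {y} F P) =
  let l , D , c = eval-derivable F
      l′ , D′ , c′ = derivable-all y _ (λ i → eval-derivable (proj₂ (P (toℕ i) (toℕ<n i))))
  in derivable 6 _ _ y (encodeVec (tabulate ys)) (D ++ᵈ D′) (∧-intro
       (concludes-derives (++⁺ˡ c))
       (all<-Fin y λ i →
         trans (cong (λ u → derives (encodeList (l ++ l′)) (judgement (codePR f) (pair (toℕ i) (encodeVec xs)) (suc u)))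
                 (trans (nth-encodeVec (tabulate ys) i) (lookup∘tabulate ys i)))
           (concludes-derives (++⁺ʳ l (c′ i)))))
  where
  ys : Fin y → ℕ
  ys i = proj₁ (P (toℕ i) (toℕ<n i))

-- Computations with bounded resources

query : SetOfNat → ℕ → ℕ → ℕ → Bool
query X n x z = (x <ᵇ n) ∧ answers X x z

-- One n bounds both the code of the derivation and the oracle questions, so the outcome depends on
-- X below n alone.
converges : SetOfNat → ℕ → (c w z : ℕ) → Bool
converges X n c w z = any< n (λ d → isDerivation (query X n) d ∧ derives d (judgement c w z))

query-mono : ∀ {X Y : SetOfNat} {m n} → m ≤ n → (∀ x → x < m → X x ≡ Y x) →
  ∀ x z → query X m x z ≡ true → query Y n x z ≡ true
query-mono m≤n X≈Y x z p =
  let x<m , a = ∧-elim p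
      lt = <ᵇ-elim x<m
  in ∧-intro (<ᵇ-intro (<-≤-trans lt m≤n)) (trans (cong (λ a → z ≡ᵇ b2n a) (sym (X≈Y x lt))) a)

-- The use principle: a computation seen at m has consulted its oracle below m only.
converges-mono : ∀ {X Y : SetOfNat} {m n} → m ≤ n → (∀ x → x < m → X x ≡ Y x) →
  ∀ c w z → converges X m c w z ≡ true → converges Y n c w z ≡ true
converges-mono {m = m} {n} m≤n X≈Y c w z p =
  let d , d<m , r = any<-elim m p
      der , con = ∧-elim r
  in any<-intro n d (<-≤-trans d<m m≤n) (∧-intro (isDerivation-mono (query-mono m≤n X≈Y) d der) con)

converges-sound : ∀ {X k} n (c : PR k) w z → converges X n (codePR c) w z ≡ true → Eval X c (decodeVec k w) z
converges-sound {X} n c w z p =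
  let d , _ , r = any<-elim n p
      der , con = ∧-elim r
  in Soundness.derivation-sound (λ x z s → ≡ᵇ-elim z (b2n (X x)) (proj₂ (∧-elim s))) d d ≤-refl der c w z con

-- Each rule asks at most one oracle question, so the use of a finite derivation is a maximum over
-- its entries.
derivation-use : ∀ {X l} → Derivation (answers X) l → Σ ℕ λ n → Derivation (query X n) l
derivation-use [] = 0 , []
derivation-use {X} {e ∷ l} (p ∷ D) =
  let m , p′ = use (fst (fst (fst e))) (fst (fst e)) (snd (fst (fst e)))
                 (fst (snd (fst e))) (snd (snd (fst e))) (snd e) p
      n , D′ = derivation-use D
  in m ⊔ n , justified-mono (query-mono {X} {X} (m≤m⊔n m n) (λ _ _ → refl)) (λ _ _ r → r) e p′ ∷
             derivation-mono (query-mono {X} {X} (m≤n⊔m m n) (λ _ _ → refl)) D′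
  where
  use : ∀ tag c b w z a → rule (answers X) tag c b w z a (encodeList l) ≡ true →
        Σ ℕ λ n → rule (query X n) tag c b w z a (encodeList l) ≡ true
  use 0 c b w z a p = 0 , p
  use 1 c b w z a p = 0 , p
  use 2 c b w z a p = 0 , p
  use 3 c b w z a p = suc (fst w) , ∧-intro (<ᵇ-intro {fst w} ≤-refl) p
  use 4 c b w z a p = 0 , p
  use 5 c b w z a p = 0 , p
  use 6 c b w z a p = 0 , p
  use (suc (suc (suc (suc (suc (suc (suc _))))))) c b w z a ()

converges-complete : ∀ {X k} {c : PR k} {v z} → Eval X c v z →
  Σ ℕ λ n → converges X n (codePR c) (encodeVec v) z ≡ true
converges-complete {X} E =
  let l , D , c = eval-derivable E
      m , D′ = derivation-use D
      d = encodeList l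
      n = m ⊔ suc d
  in n , any<-intro n d (m≤n⊔m m (suc d))
           (∧-intro (isDerivation-mono (query-mono (m≤m⊔n m (suc d)) (λ _ _ → refl)) d (isDerivation-encodeList D′))
             (concludes-derives c))

-- Binary expansions and finite strings

odd : ℕ → Bool
odd zero = false
odd (suc n) = not (odd n)

half : ℕ → ℕ
half zero = 0
half (suc n) = half n + b2n (odd n)

bit : ℕ → ℕ → Bool
bit s i = odd (rec s (λ _ → half) i)

odd-2+ : ∀ n → odd (suc (suc n)) ≡ odd n
odd-2+ n with odd n
... | true = refl
... | false = refl

half-2+ : ∀ n → half (suc (suc n)) ≡ suc (half n)
half-2+ n with odd n
... | true rewrite +-identityʳ (half n + 1) = +-comm (half n) 1
... | false rewrite +-identityʳ (half n) = +-comm (half n) 1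

half-≤ : ∀ n → half n ≤ n
half-≤ zero = z≤n
half-≤ (suc n) = ≤-trans (+-mono-≤ (half-≤ n) (b2n≤1 (odd n))) (≤-reflexive (+-comm n 1))
  where
  b2n≤1 : ∀ b → b2n b ≤ 1
  b2n≤1 true = ≤-refl
  b2n≤1 false = z≤n

⊕-half : ∀ X Y n → (X ⊕ Y) n ≡ (if odd n then Y (half n) else X (half n))
⊕-half X Y zero = refl
⊕-half X Y (suc zero) = refl
⊕-half X Y (suc (suc n)) rewrite odd-2+ n | half-2+ n = ⊕-half (X ∘ suc) (Y ∘ suc) n

⊕-local : ∀ X {Y Y′ : SetOfNat} {n} → (∀ i → i < n → Y i ≡ Y′ i) → ∀ x → x < n → (X ⊕ Y) x ≡ (X ⊕ Y′) x
⊕-local X {Y} {Y′} h x x<n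
  rewrite ⊕-half X Y x | ⊕-half X Y′ x | h (half x) (≤-<-trans (half-≤ x) x<n) = refl

odd-double : ∀ b m → odd (b2n b + 2 * m) ≡ b
odd-double true zero = refl
odd-double false zero = refl
odd-double b (suc m) = begin
  odd (b2n b + 2 * suc m)          ≡⟨ cong (λ k → odd (b2n b + k)) (*-suc 2 m) ⟩
  odd (b2n b + suc (suc (2 * m)))  ≡⟨ cong odd (trans (+-suc (b2n b) _) (cong suc (+-suc (b2n b) _))) ⟩
  odd (suc (suc (b2n b + 2 * m)))  ≡⟨ odd-2+ (b2n b + 2 * m) ⟩
  odd (b2n b + 2 * m)              ≡⟨ odd-double b m ⟩
  b                                ∎
  where open ≡-Reasoning

half-double : ∀ b m → half (b2n b + 2 * m) ≡ m
half-double true zero = refl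
half-double false zero = refl
half-double b (suc m) = begin
  half (b2n b + 2 * suc m)          ≡⟨ cong (λ k → half (b2n b + k)) (*-suc 2 m) ⟩
  half (b2n b + suc (suc (2 * m)))  ≡⟨ cong half (trans (+-suc (b2n b) _) (cong suc (+-suc (b2n b) _))) ⟩
  half (suc (suc (b2n b + 2 * m)))  ≡⟨ half-2+ (b2n b + 2 * m) ⟩
  suc (half (b2n b + 2 * m))        ≡⟨ cong suc (half-double b m) ⟩
  suc m                             ∎
  where open ≡-Reasoning

odd-half : ∀ n → n ≡ b2n (odd n) + 2 * half n
odd-half zero = refl
odd-half (suc zero) = refl
odd-half (suc (suc n)) rewrite odd-2+ n | half-2+ n = begin
  suc (suc n)                             ≡⟨ cong (2 +_) (odd-half n) ⟩
  suc (suc (b2n (odd n) + 2 * half n))    ≡⟨ cong suc (+-suc (b2n (odd n)) _) ⟨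
  suc (b2n (odd n) + suc (2 * half n))    ≡⟨ +-suc (b2n (odd n)) _ ⟨
  b2n (odd n) + suc (suc (2 * half n))    ≡⟨ cong (b2n (odd n) +_) (*-suc 2 (half n)) ⟨
  b2n (odd n) + 2 * suc (half n)          ∎
  where open ≡-Reasoning

bit-suc : ∀ s i → bit s (suc i) ≡ bit (half s) i
bit-suc s i = cong odd (shift i)
  where
  shift : ∀ i → rec s (λ _ → half) (suc i) ≡ rec (half s) (λ _ → half) i
  shift zero = refl
  shift (suc i) = cong half (shift i)

fromBits : (ℕ → Bool) → ℕ → ℕ
fromBits G zero = 0
fromBits G (suc n) = b2n (G 0) + 2 * fromBits (G ∘ suc) n

fromBits-cong : ∀ {G H : ℕ → Bool} n → (∀ i → G i ≡ H i) → fromBits G n ≡ fromBits H n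
fromBits-cong zero h = refl
fromBits-cong (suc n) h = cong₂ (λ b m → b2n b + 2 * m) (h 0) (fromBits-cong n (h ∘ suc))

bit-fromBits : ∀ G n i → i < n → bit (fromBits G n) i ≡ G i
bit-fromBits G (suc n) zero _ = odd-double (G 0) (fromBits (G ∘ suc) n)
bit-fromBits G (suc n) (suc i) (s≤s i<n) = begin
  bit (fromBits G (suc n)) (suc i)        ≡⟨ bit-suc (fromBits G (suc n)) i ⟩
  bit (half (fromBits G (suc n))) i       ≡⟨ cong (λ s → bit s i) (half-double (G 0) (fromBits (G ∘ suc) n)) ⟩
  bit (fromBits (G ∘ suc) n) i            ≡⟨ bit-fromBits (G ∘ suc) n i i<n ⟩
  G (suc i)                               ∎
  where open ≡-Reasoning

fromBits<2^ : ∀ G n → fromBits G n < 2 ^ n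
fromBits<2^ G zero = s≤s z≤n
fromBits<2^ G (suc n) = begin-strict
  b2n (G 0) + 2 * m  <⟨ +-monoˡ-< (2 * m) (b2n<2 (G 0)) ⟩
  2 + 2 * m          ≡⟨ *-suc 2 m ⟨
  2 * suc m          ≤⟨ *-monoʳ-≤ 2 (fromBits<2^ (G ∘ suc) n) ⟩
  2 * 2 ^ n          ∎
  where
  open ≤-Reasoning
  m : ℕ
  m = fromBits (G ∘ suc) n
  b2n<2 : ∀ b → b2n b < 2
  b2n<2 true = ≤-refl
  b2n<2 false = s≤s z≤n

fromBits-bit : ∀ n s → s < 2 ^ n → fromBits (bit s) n ≡ s
fromBits-bit zero zero _ = refl
fromBits-bit zero (suc s) (s≤s ())
fromBits-bit (suc n) s s<2^ = begin
  b2n (odd s) + 2 * fromBits (bit s ∘ suc) n    ≡⟨ cong (λ m → b2n (odd s) + 2 * m) (fromBits-cong n (bit-suc s)) ⟩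
  b2n (odd s) + 2 * fromBits (bit (half s)) n   ≡⟨ cong (λ m → b2n (odd s) + 2 * m) (fromBits-bit n (half s) half<) ⟩
  b2n (odd s) + 2 * half s                      ≡⟨ odd-half s ⟨
  s                                             ∎
  where
  open ≡-Reasoning
  half< : half s < 2 ^ n
  half< = *-cancelˡ-< 2 (half s) (2 ^ n)
    (≤-<-trans (≤-trans (m≤n+m (2 * half s) (b2n (odd s))) (≤-reflexive (sym (odd-half s)))) s<2^)

-- `encode` is bijective base two with digits 1 and 2, least significant first. Adding one turns it
-- into the ordinary binary expansion with an extra leading 1 in place n, so the strings of length n
-- are the numbers `s + 2 ^ n ∸ 1` with s below `2 ^ n`.
suc-encode-prefix : ∀ G n → suc (encode (prefix G n)) ≡ fromBits G n + 2 ^ n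
suc-encode-prefix G zero = refl
suc-encode-prefix G (suc n) = begin
  suc (encode (prefix G (suc n)))                                  ≡⟨ encode-∷ (G 0) (prefix (G ∘ suc) n) ⟩
  b2n (G 0) + 2 * suc (encode (prefix (G ∘ suc) n))                ≡⟨ cong (λ m → b2n (G 0) + 2 * m) (suc-encode-prefix (G ∘ suc) n) ⟩
  b2n (G 0) + 2 * (fromBits (G ∘ suc) n + 2 ^ n)                   ≡⟨ cong (b2n (G 0) +_) (*-distribˡ-+ 2 (fromBits (G ∘ suc) n) (2 ^ n)) ⟩
  b2n (G 0) + (2 * fromBits (G ∘ suc) n + 2 * 2 ^ n)               ≡⟨ +-assoc (b2n (G 0)) _ _ ⟨
  fromBits G (suc n) + 2 ^ suc n                                   ∎
  where
  open ≡-Reasoning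
  encode-∷ : ∀ b σ → suc (encode (b ∷ σ)) ≡ b2n b + 2 * suc (encode σ)
  encode-∷ true σ rewrite *-suc 2 (encode σ) | +-comm (2 * encode σ) 2 = refl
  encode-∷ false σ rewrite *-suc 2 (encode σ) | +-comm (2 * encode σ) 1 = refl

encode-prefix : ∀ G n → encode (prefix G n) ≡ fromBits G n + 2 ^ n ∸ 1
encode-prefix G n = cong (_∸ 1) (suc-encode-prefix G n)

-- Successor in bijective base two: `false` is the digit 1, and `true` is the digit 2, which
-- carries.
increment : List Bool → List Bool
increment [] = false ∷ []
increment (false ∷ σ) = true ∷ σ
increment (true ∷ σ) = false ∷ increment σ

encode-increment : ∀ σ → encode (increment σ) ≡ suc (encode σ)
encode-increment [] = refl
encode-increment (false ∷ σ) = +-suc (2 * encode σ) 1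
encode-increment (true ∷ σ) =
  trans (cong (λ m → 2 * m + 1) (encode-increment σ))
    (trans (cong (_+ 1) (*-suc 2 (encode σ))) (cong suc (sym (+-suc (2 * encode σ) 1))))

decode : ℕ → List Bool
decode zero = []
decode (suc n) = increment (decode n)

encode-decode : ∀ n → encode (decode n) ≡ n
encode-decode zero = refl
encode-decode (suc n) = trans (encode-increment (decode n)) (cong suc (encode-decode n))

-- Constraints and conditions

-- A constraint pair (pair c b) w says that the program c yields b on no input pair y w;
-- a condition is a coded list of constraints.
violates : SetOfNat → ℕ → ℕ → Bool
violates X n θ = any< n (λ y → converges X n (fst (fst θ)) (pair (pair y (snd θ)) 0) (snd (fst θ)))

excludes : ℕ → SetOfNat → ℕ → Bool
excludes p X n = any< p (λ i → not (nth p i ≡ᵇ 0) ∧ violates X n (nth p i))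

violates-mono : ∀ {X Y m n} → m ≤ n → (∀ x → x < m → X x ≡ Y x) → ∀ θ →
  violates X m θ ≡ true → violates Y n θ ≡ true
violates-mono {m = m} {n} m≤n X≈Y θ p =
  let y , y<m , q = any<-elim m p
  in any<-intro n y (<-≤-trans y<m m≤n)
       (converges-mono m≤n X≈Y (fst (fst θ)) (pair (pair y (snd θ)) 0) (snd (fst θ)) q)

infix 4 _∈ₚ_

-- Zero is barred because padding would make it a member of every list.
data _∈ₚ_ (θ p : ℕ) : Set where
  at : ∀ i → nth p i ≡ θ → ¬ θ ≡ 0 → θ ∈ₚ p

excludes-elim : ∀ {p X n} → excludes p X n ≡ true → Σ ℕ λ θ → θ ∈ₚ p × violates X n θ ≡ true
excludes-elim {p} r =
  let i , _ , q = any<-elim p r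
      nz , e = ∧-elim q
  in nth p i , at i refl (λ z → not-elim nz (≡ᵇ-intro z)) , e

excludes-intro : ∀ {θ p X n} → θ ∈ₚ p → violates X n θ ≡ true → excludes p X n ≡ true
excludes-intro {p = p} (at i refl nz) v =
  any<-intro p i (nth-nonzero nz) (∧-intro (not-intro (λ z → nz (≡ᵇ-elim _ 0 z))) v)

excludes-mono : ∀ {p X Y m n} → m ≤ n → (∀ x → x < m → X x ≡ Y x) →
  excludes p X m ≡ true → excludes p Y n ≡ true
excludes-mono m≤n X≈Y r =
  let θ , θ∈ , v = excludes-elim r in excludes-intro θ∈ (violates-mono m≤n X≈Y θ v)

-- Decidability of the coded notions

module _ {Z : SetOfNat} where

  oddᵈ : ∀ {k} {f : Vec ℕ k → ℕ} → Computable Z f → Decidable Z (λ v → odd (f v))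
  oddᵈ {f = f} cf = decidable-≗ (λ v → lemma (f v)) (recᶜ cf (constᶜ 0) (constᶜ 1 ∸ᶜ wkᶜ varᶜ))
    where
    lemma : ∀ n → rec 0 (λ _ z → 1 ∸ z) n ≡ b2n (odd n)
    lemma zero = refl
    lemma (suc n) rewrite lemma n with odd n
    ... | true = refl
    ... | false = refl

  halfᶜ : ∀ {k} {f : Vec ℕ k → ℕ} → Computable Z f → Computable Z (λ v → half (f v))
  halfᶜ {f = f} cf = computable-≗ (λ v → lemma (f v))
    (recᶜ cf (constᶜ 0) (wkᶜ varᶜ +ᶜ characteristic (oddᵈ varᶜ)))
    where
    lemma : ∀ n → rec 0 (λ i z → z + b2n (odd i)) n ≡ half n
    lemma zero = refl
    lemma (suc n) = cong (_+ b2n (odd n)) (lemma n)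

  bitᵈ : ∀ {k} {f g : Vec ℕ k → ℕ} → Computable Z f → Computable Z g → Decidable Z (λ v → bit (f v) (g v))
  bitᵈ cf cg = oddᵈ (recᶜ cg cf (halfᶜ (wkᶜ varᶜ)))

  opaque
    unfolding derives

    derivesᵈ : ∀ {k} {f g : Vec ℕ k → ℕ} → Computable Z f → Computable Z g →
      Decidable Z (λ v → derives (f v) (g v))
    derivesᵈ cd cj = any<ᵈ cd (fstᶜ (nthᶜ (wkᶜ cd) varᶜ) ≡ᵈ wkᶜ cj)

  judgementᶜ : ∀ {k} {c w z : Vec ℕ k → ℕ} → Computable Z c → Computable Z w → Computable Z z →
    Computable Z (λ v → judgement (c v) (w v) (z v))
  judgementᶜ cc cw cz = pairᶜ cc (pairᶜ cw cz)

  -- The unknown half of the oracle is replaced by the finite string with number s. Thus everything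
  -- built on `query` is decidable in Z, uniformly in s.
  queryᵈ : ∀ {k} {s n x z : Vec ℕ k → ℕ} → Computable Z s → Computable Z n → Computable Z x → Computable Z z →
    Decidable Z (λ v → query (Z ⊕ bit (s v)) (n v) (x v) (z v))
  queryᵈ {s = s} {n} {x} {z} cs cn cx cz = (cx <ᵈ cn) ∧ᵈ (cz ≡ᵈ characteristic answer)
    where
    answer : Decidable Z (λ v → (Z ⊕ bit (s v)) (x v))
    answer = decidable-≗ (λ v → cong b2n (sym (⊕-half Z (bit (s v)) (x v))))
      (characteristic (ifᵈ (oddᵈ cx) (bitᵈ cs (halfᶜ cx)) (oracleᶜ (halfᶜ cx))))

  ruleᵈ : ∀ {k} {s n t c b w z a d : Vec ℕ k → ℕ} → Computable Z s → Computable Z n →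
    Computable Z t → Computable Z c → Computable Z b → Computable Z w → Computable Z z → Computable Z a → Computable Z d →
    Decidable Z (λ v → rule (query (Z ⊕ bit (s v)) (n v)) (t v) (c v) (b v) (w v) (z v) (a v) (d v))
  ruleᵈ {s = s} {n} {t} {c} {b} {w} {z} {a} {d} cs cn ct cc cb cw cz ca cd =
    decidable-≗ (λ v → cong b2n (lemma (query (Z ⊕ bit (s v)) (n v)) (t v) (c v) (b v) (w v) (z v) (a v) (d v)))
      (characteristic
        (ifᵈ (ct ≡ᵈ constᶜ 0) (cz ≡ᵈ constᶜ 0)
        (ifᵈ (ct ≡ᵈ constᶜ 1) (cz ≡ᵈ sucᶜ (fstᶜ cw))
        (ifᵈ (ct ≡ᵈ constᶜ 2) (cz ≡ᵈ nthᶜ cw cb)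
        (ifᵈ (ct ≡ᵈ constᶜ 3) (queryᵈ cs cn (fstᶜ cw) cz)
        (ifᵈ (ct ≡ᵈ constᶜ 4)
          (all<ᵈ (fstᶜ (sndᶜ cb))
            (derivesᵈ (wkᶜ cd) (judgementᶜ (nthᶜ (wkᶜ (sndᶜ (sndᶜ cb))) varᶜ) (wkᶜ cw) (nthᶜ (wkᶜ ca) varᶜ))) ∧ᵈ
           derivesᵈ cd (judgementᶜ (fstᶜ cb) ca cz))
        (ifᵈ (ct ≡ᵈ constᶜ 5)
          (ifᵈ (fstᶜ cw ≡ᵈ constᶜ 0)
            (derivesᵈ cd (judgementᶜ (fstᶜ cb) (sndᶜ cw) cz))
            (derivesᵈ cd (judgementᶜ cc (pairᶜ (predᶜ (fstᶜ cw)) (sndᶜ cw)) ca) ∧ᵈ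
             derivesᵈ cd (judgementᶜ (sndᶜ cb) (pairᶜ (predᶜ (fstᶜ cw)) (pairᶜ ca (sndᶜ cw))) cz)))
        (ifᵈ (ct ≡ᵈ constᶜ 6)
          (derivesᵈ cd (judgementᶜ cb (pairᶜ cz cw) (constᶜ 0)) ∧ᵈ
           all<ᵈ cz (derivesᵈ (wkᶜ cd) (judgementᶜ (wkᶜ cb) (pairᶜ varᶜ (wkᶜ cw)) (sucᶜ (nthᶜ (wkᶜ ca) varᶜ)))))
        (decidable (constᶜ 0))))))))))
    where
    lemma : ∀ q t c b w z a d →
      (if t ≡ᵇ 0 then rule q 0 c b w z a d else
       if t ≡ᵇ 1 then rule q 1 c b w z a d else
       if t ≡ᵇ 2 then rule q 2 c b w z a d else
       if t ≡ᵇ 3 then rule q 3 c b w z a d else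
       if t ≡ᵇ 4 then rule q 4 c b w z a d else
       if t ≡ᵇ 5 then rule q 5 c b w z a d else
       if t ≡ᵇ 6 then rule q 6 c b w z a d else false) ≡ rule q t c b w z a d
    lemma q 0 c b w z a d = refl
    lemma q 1 c b w z a d = refl
    lemma q 2 c b w z a d = refl
    lemma q 3 c b w z a d = refl
    lemma q 4 c b w z a d = refl
    lemma q 5 c b w z a d = refl
    lemma q 6 c b w z a d = refl
    lemma q (suc (suc (suc (suc (suc (suc (suc _))))))) c b w z a d = refl

  isDerivationᵈ : ∀ {k} {s n d : Vec ℕ k → ℕ} → Computable Z s → Computable Z n → Computable Z d →
    Decidable Z (λ v → isDerivation (query (Z ⊕ bit (s v)) (n v)) (d v))
  isDerivationᵈ cs cn cd = all<ᵈ cd ((ce ≡ᵈ constᶜ 0) ∨ᵈ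
    ruleᵈ (wkᶜ cs) (wkᶜ cn) (fstᶜ (fstᶜ (fstᶜ ce))) (fstᶜ (fstᶜ ce)) (sndᶜ (fstᶜ (fstᶜ ce)))
      (fstᶜ (sndᶜ (fstᶜ ce))) (sndᶜ (sndᶜ (fstᶜ ce))) (sndᶜ ce) (dropᶜ (sucᶜ varᶜ) (wkᶜ cd)))
    where
    ce = nthᶜ (wkᶜ cd) varᶜ

  convergesᵈ : ∀ {k} {s n c w z : Vec ℕ k → ℕ} → Computable Z s → Computable Z n →
    Computable Z c → Computable Z w → Computable Z z →
    Decidable Z (λ v → converges (Z ⊕ bit (s v)) (n v) (c v) (w v) (z v))
  convergesᵈ cs cn cc cw cz = any<ᵈ cn (isDerivationᵈ (wkᶜ cs) (wkᶜ cn) varᶜ ∧ᵈ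
    derivesᵈ varᶜ (judgementᶜ (wkᶜ cc) (wkᶜ cw) (wkᶜ cz)))

  violatesᵈ : ∀ {k} {s n θ : Vec ℕ k → ℕ} → Computable Z s → Computable Z n → Computable Z θ →
    Decidable Z (λ v → violates (Z ⊕ bit (s v)) (n v) (θ v))
  violatesᵈ cs cn cθ = any<ᵈ cn (convergesᵈ (wkᶜ cs) (wkᶜ cn) (fstᶜ (fstᶜ (wkᶜ cθ)))
    (pairᶜ (pairᶜ varᶜ (sndᶜ (wkᶜ cθ))) (constᶜ 0)) (sndᶜ (fstᶜ (wkᶜ cθ))))

  excludesᵈ : ∀ {k} {p s n : Vec ℕ k → ℕ} → Computable Z p → Computable Z s → Computable Z n →
    Decidable Z (λ v → excludes (p v) (Z ⊕ bit (s v)) (n v))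
  excludesᵈ cp cs cn = any<ᵈ cp (notᵈ (nthᶜ (wkᶜ cp) varᶜ ≡ᵈ constᶜ 0) ∧ᵈ
    violatesᵈ (wkᶜ cs) (wkᶜ cn) (nthᶜ (wkᶜ cp) varᶜ))

-- Determinism of evaluation

eval-deterministic : ∀ {X k} {c : PR k} {v y z} → Eval X c v y → Eval X c v z → y ≡ z
eval-deterministic e-zer e-zer = refl
eval-deterministic e-succ e-succ = refl
eval-deterministic e-proj e-proj = refl
eval-deterministic e-orc e-orc = refl
eval-deterministic {X} (e-comp {f = f} {z = y} E F) (e-comp {z = z} E′ F′) =
  eval-deterministic F (subst (λ u → Eval X f u z) (sym (tabulate-cong (λ i → eval-deterministic (E i) (E′ i)))) F′)
eval-deterministic (e-prec0 G) (e-prec0 G′) = eval-deterministic G G′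
eval-deterministic {X} (e-precS {h = h} {n} {xs} P H) (e-precS {w = w} P′ H′) =
  eval-deterministic H (subst (λ u → Eval X h (n ∷ u ∷ xs) w) (sym (eval-deterministic P P′)) H′)
eval-deterministic (e-mu {y = y} F P) (e-mu {y = z} F′ P′) with <-cmp y z
... | tri< y<z _ _ = contradiction (eval-deterministic F (proj₂ (P′ y y<z))) λ ()
... | tri≈ _ y≡z _ = y≡z
... | tri> _ _ z<y = contradiction (eval-deterministic (proj₂ (P z z<y)) F′) λ ()

b2n-injective : ∀ {a b} → b2n a ≡ b2n b → a ≡ b
b2n-injective {true} {true} _ = refl
b2n-injective {false} {false} _ = refl

-- Alternating quantifier prefixes

mutual
  exForm-map : ∀ n {P Q : Vec ℕ n → Set} → (∀ ys → P ys → Q ys) → ExForm n P → ExForm n Q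
  exForm-map zero h p = h [] p
  exForm-map (suc n) h (y , p) = y , allForm-map n (λ ys → h (y ∷ ys)) p

  allForm-map : ∀ n {P Q : Vec ℕ n → Set} → (∀ ys → P ys → Q ys) → AllForm n P → AllForm n Q
  allForm-map zero h p = h [] p
  allForm-map (suc n) h p y = exForm-map n (λ ys → h (y ∷ ys)) (p y)

mutual
  exForm-tautology : ∀ n {P : Vec ℕ n → Set} → (∀ ys → P ys) → ExForm n P
  exForm-tautology zero h = h []
  exForm-tautology (suc n) h = 0 , allForm-tautology n (λ ys → h (0 ∷ ys))

  allForm-tautology : ∀ n {P : Vec ℕ n → Set} → (∀ ys → P ys) → AllForm n P
  allForm-tautology zero h = h []
  allForm-tautology (suc n) h y = exForm-tautology n (λ ys → h (y ∷ ys))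

-- The two dual prefixes are strategies in the same game: each variable is chosen by one side and
-- arbitrary for the other. Playing them against each other yields a common tuple.
exForm-allForm-meet : ∀ n {P Q : Vec ℕ n → Set} → ExForm n P → AllForm n Q → Σ (Vec ℕ n) λ ys → P ys × Q ys
exForm-allForm-meet zero p q = [] , p , q
exForm-allForm-meet (suc n) (y , p) q =
  let ys , q′ , p′ = exForm-allForm-meet n (q y) p in y ∷ ys , p′ , q′

module _ (lem : LEM) where

  ¬∀⇒∃¬ : {P : ℕ → Set} → ¬ (∀ y → P y) → Σ ℕ λ y → ¬ P y
  ¬∀⇒∃¬ {P} h with lem (Σ ℕ λ y → ¬ P y)
  ... | inj₁ e = e
  ... | inj₂ ne = contradiction all h
    where
    all : ∀ y → P y
    all y with lem (P y)
    ... | inj₁ p = p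
    ... | inj₂ np = contradiction (y , np) ne

  mutual
    ¬allForm : ∀ n {P : Vec ℕ n → Set} → ¬ AllForm n P → ExForm n (λ ys → ¬ P ys)
    ¬allForm zero h = h
    ¬allForm (suc n) h = let y , g = ¬∀⇒∃¬ h in y , ¬exForm n g

    ¬exForm : ∀ n {P : Vec ℕ n → Set} → ¬ ExForm n P → AllForm n (λ ys → ¬ P ys)
    ¬exForm zero h = h
    ¬exForm (suc n) h y = ¬allForm n λ p → h (y , p)

  ¬allForm-bool : ∀ n (S : Vec ℕ n → Bool) b → (¬ AllForm n (λ ys → S ys ≡ b)) ⇔ ExForm n (λ ys → S ys ≡ not b)
  ¬allForm-bool n S b = mk⇔
    (λ h → exForm-map n (λ _ → ¬-not) (¬allForm n h))
    (λ ex al → let _ , p , q = exForm-allForm-meet n ex al in not-¬ q p)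

-- Conditions and forcing

infix 4 _⊑_

-- Extending means prepending constraints. With the number of dropped entries as witness this is
-- decidable, so quantifying over extensions costs one number quantifier.
_⊑_ : ℕ → ℕ → Set
p′ ⊑ p = Σ ℕ λ i → drop i p′ ≡ p

⊑-refl : ∀ {p} → p ⊑ p
⊑-refl = 0 , refl

⊑-trans : ∀ {p q r} → p ⊑ q → q ⊑ r → p ⊑ r
⊑-trans {p} (i , refl) (j , refl) = j + i , sym (drop-drop j i p)

cons-⊑ : ∀ θ p → pair θ p ⊑ p
cons-⊑ θ p = 1 , snd-pair θ p

∈ₚ-⊑ : ∀ {θ p p′} → p′ ⊑ p → θ ∈ₚ p → θ ∈ₚ p′
∈ₚ-⊑ {p′ = p′} (i , refl) (at j eq nz) = at (j + i) (trans (sym (nth-drop j i p′)) eq) nz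

∈ₚ-cons : ∀ {θ θ′ p} → θ ∈ₚ pair θ′ p → θ ≡ θ′ ⊎ θ ∈ₚ p
∈ₚ-cons {θ} {θ′} {p} (at zero eq nz) = inj₁ (trans (sym eq) (nth-zero-pair θ′ p))
∈ₚ-cons {θ} {θ′} {p} (at (suc i) eq nz) = inj₂ (at i (trans (sym (nth-suc-pair θ′ p i)) eq) nz)

here-∈ₚ : ∀ t w p → pair t w ∈ₚ pair (pair t w) p
here-∈ₚ t w p = at 0 (nth-zero-pair (pair t w) p) pair≢0

-- a = pair n c codes the Π_n set whose matrix is decided by the program with code c.
Φ : SetOfNat → ℕ → ℕ → Set
Φ Z a x = AllForm (fst a) (λ ys → Σ ℕ λ n → converges Z n (snd a) (encodeVec (x ∷ ys)) 1 ≡ true)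

-- By determinism, a total program turns both truth values of R into convergence statements. This
-- allows a negated matrix to be expressed by changing the required output.
converges-value : ∀ {X k} {c : PR k} {R : Vec ℕ k → Bool} → (∀ v → Eval X c v (b2n (R v))) →
  ∀ v b → R v ≡ b ⇔ (Σ ℕ λ n → converges X n (codePR c) (encodeVec v) (b2n b) ≡ true)
converges-value {X} {k} {c} {R} ev v b = mk⇔
  (λ { refl → converges-complete (ev v) })
  (λ (n , p) → b2n-injective (eval-deterministic (ev v)
    (subst (λ u → Eval X c u (b2n b)) (decodeVec-encodeVec v) (converges-sound n c _ _ p))))

Π-coded : ∀ {Z n A} → IsΠ Z n A → Σ ℕ λ a → ∀ x → (A x ≡ true) ⇔ Φ Z a x
Π-coded {Z} {n} {A} (R , (c , ev) , A⇔) = pair n (codePR c) , λ x → mk⇔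
  (λ Ax → subst (λ S → S) (uncode x)
    (allForm-map n (λ ys → to (converges-value ev (x ∷ ys) true)) (to (A⇔ x) Ax)))
  (λ p → from (A⇔ x)
    (allForm-map n (λ ys → from (converges-value ev (x ∷ ys) true)) (subst (λ S → S) (sym (uncode x)) p)))
  where
  Φ′ : ℕ → ℕ → ℕ → Set
  Φ′ m d x = AllForm m (λ ys → Σ ℕ λ n → converges Z n d (encodeVec (x ∷ ys)) 1 ≡ true)
  uncode : ∀ x → Φ′ n (codePR c) x ≡ Φ Z (pair n (codePR c)) x
  uncode x = cong₂ (λ m d → Φ′ m d x) (sym (fst-pair n (codePR c))) (sym (snd-pair n (codePR c)))

module Forcing (lem : LEM) (Z : SetOfNat) (T : List Bool → Bool) (cT : ComputableTree Z T)
               (tree : IsTree T) (inf : InfiniteTree T) where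

  member : ℕ → Bool
  member k = T (decode k)

  memberᵈ : ∀ {k} {f : Vec ℕ k → ℕ} → Computable Z f → Decidable Z (λ v → member (f v))
  memberᵈ {f = f} cf = decidable (computable (comp (proj₁ cT) (λ _ → program cf)) λ v →
    e-comp {ys = λ _ → f v} (λ _ → computes cf v)
      (subst (λ x → Eval Z (proj₁ cT) (x ∷ []) (b2n (member (f v)))) (encode-decode (f v))
        (proj₂ cT (decode (f v)))))

  member-encode : ∀ σ → member (encode σ) ≡ T σ
  member-encode σ = b2n-injective (eval-deterministic
    (subst (λ x → Eval Z (proj₁ cT) (x ∷ []) (b2n (member (encode σ)))) (encode-decode (encode σ))
      (proj₂ cT (decode (encode σ)))) (proj₂ cT σ))

  Admits : ℕ → (ℕ → Bool) → ℕ → Set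
  Admits p G n = T (prefix G n) ≡ true × ¬ excludes p (Z ⊕ G) n ≡ true

  Consistent : ℕ → Set
  Consistent p = ∀ n → Σ (ℕ → Bool) λ G → Admits p G n

  consistentAt : ℕ → ℕ → Bool
  -- Here s runs through the strings of length n, and `s + 2 ^ n ∸ 1` is the code of such a string
  -- under `encode`.
  consistentAt p n = any< (2 ^ n) (λ s → member (s + 2 ^ n ∸ 1) ∧ not (excludes p (Z ⊕ bit s) n))

  consistentAtᵈ : ∀ {k} {f g : Vec ℕ k → ℕ} → Computable Z f → Computable Z g → Decidable Z (λ v → consistentAt (f v) (g v))
  consistentAtᵈ cp cn = any<ᵈ (2^ᶜ cn)
    (memberᵈ (varᶜ +ᶜ 2^ᶜ (wkᶜ cn) ∸ᶜ constᶜ 1) ∧ᵈ notᵈ (excludesᵈ (wkᶜ cp) varᶜ (wkᶜ cn)))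

  consistentAt-intro : ∀ p G n → Admits p G n → consistentAt p n ≡ true
  consistentAt-intro p G n (t , ne) = any<-intro (2 ^ n) s (fromBits<2^ G n) (∧-intro
    (trans (cong member (sym (encode-prefix G n))) (trans (member-encode (prefix G n)) t))
    (not-intro λ e → ne (excludes-mono ≤-refl (⊕-local Z (bit-fromBits G n)) e)))
    where
    s : ℕ
    s = fromBits G n

  consistentAt-elim : ∀ p n → consistentAt p n ≡ true → Σ (ℕ → Bool) λ G → Admits p G n
  consistentAt-elim p n c =
    let s , s< , q = any<-elim (2 ^ n) c
        m , ne = ∧-elim q
    in bit s ,
       trans (sym (member-encode (prefix (bit s) n)))
         (trans (cong member (trans (encode-prefix (bit s) n) (cong (λ k → k + 2 ^ n ∸ 1) (fromBits-bit n s s<)))) m) ,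
       not-elim ne

  consistent-cons : ∀ {θ p} → θ ∈ₚ p → Consistent p → Consistent (pair θ p)
  consistent-cons {θ} {p} θ∈p c n = let G , t , ne = c n in G , t , λ e →
    let θ′ , θ′∈ , v = excludes-elim e in ne (excludes-intro (old (∈ₚ-cons θ′∈)) v)
    where
    old : ∀ {θ′} → θ′ ≡ θ ⊎ θ′ ∈ₚ p → θ′ ∈ₚ p
    old (inj₁ refl) = θ∈p
    old (inj₂ θ′∈p) = θ′∈p

  -- Level m speaks about the Π_{m+1} formula ∀y₁ ¬∀y₂ ¬ … ¬∀yₘ₊₁ "program c does not yield b
  -- on (yₘ₊₁, …, y₁, w)" with t = pair c b. Forceable says that some consistent extension forces it.
  mutual
    Forceable : ℕ → (p t w : ℕ) → Set
    Forceable zero p t w = Consistent (pair (pair t w) p)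
    Forceable (suc m) p t w = Consistent p × Forces (suc m) p t w

    Forces : ℕ → (p t w : ℕ) → Set
    Forces zero p t w = pair t w ∈ₚ p
    Forces (suc m) p t w = ∀ y p′ → p′ ⊑ p → ¬ Forceable m p′ t (pair y w)

  -- A positive reason for failure, unlike mere absence of forcing: it persists under extension and
  -- makes the formula false on the generic path.
  Refutes : ℕ → (p t w : ℕ) → Set
  Refutes zero p t w = ¬ Consistent (pair (pair t w) p)
  Refutes (suc m) p t w = Σ ℕ λ y → Forces m p t (pair y w)

  Extension : ℕ → (ℕ → Set) → Set
  Extension p P = Σ ℕ λ p′ → p′ ⊑ p × Consistent p′ × P p′

  forceable-extension : ∀ m {p t w} → Forceable m p t w → Extension p (λ p′ → Forces m p′ t w)
  forceable-extension zero {p} {t} {w} c = pair (pair t w) p , cons-⊑ _ p , c , here-∈ₚ t w p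
  forceable-extension (suc m) {p} (c , f) = p , ⊑-refl , c , f

  forces-forceable : ∀ m {p t w} → Consistent p → Forces m p t w → Forceable m p t w
  forces-forceable zero c f = consistent-cons f c
  forces-forceable (suc m) c f = c , f

  -- At the bottom p itself refutes. Above, failure provides some y and an extension at which the
  -- lower level is `Forceable`; passing to a condition that forces it refutes the formula.
  ¬forceable-extension : ∀ m {p t w} → Consistent p → ¬ Forceable m p t w → Extension p (λ p′ → Refutes m p′ t w)
  ¬forceable-extension zero {p} c nf = p , ⊑-refl , c , nf
  ¬forceable-extension (suc m) {p} {t} {w} c nf
    with lem (Σ ℕ λ y → Σ ℕ λ p′ → p′ ⊑ p × Forceable m p′ t (pair y w))
  ... | inj₁ (y , p′ , p′⊑p , f) =
    let p″ , p″⊑p′ , c″ , f″ = forceable-extension m f in p″ , ⊑-trans p″⊑p′ p′⊑p , c″ , y , f″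
  ... | inj₂ ne = contradiction (c , λ y p′ p′⊑p f → ne (y , p′ , p′⊑p , f)) nf

  forces-⊑ : ∀ m {p p′ t w} → p′ ⊑ p → Forces m p t w → Forces m p′ t w
  forces-⊑ zero p′⊑p f = ∈ₚ-⊑ p′⊑p f
  forces-⊑ (suc m) p′⊑p f y q q⊑p′ = f y q (⊑-trans q⊑p′ p′⊑p)

  refutes-⊑ : ∀ m {p p′ t w} → p′ ⊑ p → Refutes m p t w → Refutes m p′ t w
  refutes-⊑ zero {p} {p′} {t} {w} p′⊑p nc c = nc λ n →
    let G , τ , ne = c n in G , τ , λ e →
      let θ , θ∈ , v = excludes-elim e in ne (excludes-intro (new (∈ₚ-cons θ∈)) v)
    where
    new : ∀ {θ} → θ ≡ pair t w ⊎ θ ∈ₚ p → θ ∈ₚ pair (pair t w) p′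
    new (inj₁ refl) = here-∈ₚ t w p′
    new (inj₂ θ∈p) = ∈ₚ-⊑ (⊑-trans (cons-⊑ _ p′) p′⊑p) θ∈p
  refutes-⊑ (suc m) p′⊑p (y , f) = y , forces-⊑ m p′⊑p f

  -- Complexity of the forcing relation

  -- In next and extends, u codes (p, t, w), and z codes (y, p′, i) with i witnessing p′ ⊑ p.
  next : ℕ → ℕ → ℕ
  next u z = pair (fst (snd z)) (pair (fst (snd u)) (pair (fst z) (snd (snd u))))

  extends : ℕ → ℕ → Bool
  extends u z = drop (snd (snd z)) (fst (snd z)) ≡ᵇ fst u

  -- Consistency and the clause about extensions share the leading universal variable: it is read as
  -- a length in the first conjunct and as a code of (y, p′, i) in the second. Negating level m
  -- flips its prefix, so each level adds exactly one quantifier.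
  matrix : ∀ m → Vec ℕ (suc (suc m)) → Bool
  matrix zero v = consistentAt (pair (snd (head v)) (fst (head v))) (head (tail v))
  matrix (suc m) v =
    consistentAt (fst (head v)) (head (tail v)) ∧
    not (extends (head v) (head (tail v)) ∧ matrix m (next (head v) (head (tail v)) ∷ tail (tail v)))

  matrixᵈ : ∀ m → Decidable Z (matrix m)
  matrixᵈ zero = consistentAtᵈ (pairᶜ (sndᶜ varᶜ) (fstᶜ varᶜ)) (wkᶜ varᶜ)
  matrixᵈ (suc m) =
    consistentAtᵈ (fstᶜ u) z ∧ᵈ
    notᵈ ((dropᶜ (sndᶜ (sndᶜ z)) (fstᶜ (sndᶜ z)) ≡ᵈ fstᶜ u) ∧ᵈ
          decidable (updateᶜ (pairᶜ (fstᶜ (sndᶜ z)) (pairᶜ (fstᶜ (sndᶜ u)) (pairᶜ (fstᶜ z) (sndᶜ (sndᶜ u)))))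
                             (skipᶜ (characteristic (matrixᵈ m)))))
    where
    u = varᶜ
    z = wkᶜ varᶜ

  state : (p t w : ℕ) → ℕ
  state p t w = pair p (pair t w)

  next-state : ∀ p t w y p′ i → next (state p t w) (pair y (pair p′ i)) ≡ state p′ t (pair y w)
  next-state p t w y p′ i
    rewrite snd-pair y (pair p′ i) | fst-pair y (pair p′ i) | fst-pair p′ i
          | snd-pair p (pair t w) | fst-pair t w | snd-pair t w = refl

  next-state′ : ∀ p t w z → next (state p t w) z ≡ state (fst (snd z)) t (pair (fst z) w)
  next-state′ p t w z rewrite snd-pair p (pair t w) | fst-pair t w | snd-pair t w = refl

  -- Neither `a` nor the guard `e` depends on ys, so both can sit inside the prefix; when the guard
  -- is false, dummy witnesses fill it.
  guarded-intro : ∀ n a e (r : Vec ℕ n → Bool) → a ≡ true → (e ≡ true → ¬ AllForm n (λ ys → r ys ≡ true)) →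
    ExForm n (λ ys → a ∧ not (e ∧ r ys) ≡ true)
  guarded-intro n a false r refl h = exForm-tautology n λ _ → refl
  guarded-intro n a true r refl h = exForm-map n (λ ys → not-intro) (¬allForm lem n (h refl))

  guarded-elim : ∀ n a e (r : Vec ℕ n → Bool) → ExForm n (λ ys → a ∧ not (e ∧ r ys) ≡ true) →
    a ≡ true × (e ≡ true → ¬ AllForm n (λ ys → r ys ≡ true))
  guarded-elim n a e r x =
    (let _ , p , _ = exForm-allForm-meet n {Q = λ _ → ⊤} x (allForm-tautology n λ _ → tt) in proj₁ (∧-elim p)) ,
    λ e≡ f → let _ , p , q = exForm-allForm-meet n x f in not-elim (proj₂ (∧-elim {a} p)) (∧-intro e≡ q)

  mutual
    forceable-matrix : ∀ m p t w → Forceable m p t w →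
      AllForm (suc m) (λ ys → matrix m (state p t w ∷ ys) ≡ true)
    forceable-matrix zero p t w c n
      rewrite snd-pair p (pair t w) | fst-pair p (pair t w) =
      let G , ad = c n in consistentAt-intro _ G n ad
    forceable-matrix (suc m) p t w (c , f) z
      with eq ← fst-pair p (pair t w) =
      guarded-intro (suc m) _ (extends (state p t w) z) (λ ys → matrix m (next (state p t w) z ∷ ys))
        (subst (λ q → consistentAt q z ≡ true) (sym eq)
          (let G , ad = c z in consistentAt-intro p G z ad))
        (λ e al → f (fst z) (fst (snd z)) (snd (snd z) , trans (≡ᵇ-elim _ _ e) eq)
          (matrix-forceable m _ t _
            (subst (λ u → AllForm (suc m) (λ ys → matrix m (u ∷ ys) ≡ true)) (next-state′ p t w z) al)))

    matrix-forceable : ∀ m p t w →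
      AllForm (suc m) (λ ys → matrix m (state p t w ∷ ys) ≡ true) → Forceable m p t w
    matrix-forceable zero p t w al n =
      consistentAt-elim _ n
        (subst (λ q → consistentAt q n ≡ true) (cong₂ pair (snd-pair p (pair t w)) (fst-pair p (pair t w))) (al n))
    matrix-forceable (suc m) p t w al =
      (λ n → consistentAt-elim p n (subst (λ q → consistentAt q n ≡ true) (fst-pair p (pair t w))
        (proj₁ (guarded-elim (suc m) _ (extends (state p t w) n) (λ ys → matrix m (next (state p t w) n ∷ ys)) (al n))))) ,
      λ { y p′ (i , eq) fo →
        proj₂ (guarded-elim (suc m) _ (extends (state p t w) (pair y (pair p′ i)))
            (λ ys → matrix m (next (state p t w) (pair y (pair p′ i)) ∷ ys)) (al (pair y (pair p′ i))))
          (extends-intro y p′ i eq)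
          (subst (λ u → AllForm (suc m) (λ ys → matrix m (u ∷ ys) ≡ true)) (sym (next-state p t w y p′ i))
            (forceable-matrix m p′ t (pair y w) fo)) }
      where
      extends-intro : ∀ y p′ i → drop i p′ ≡ p → extends (state p t w) (pair y (pair p′ i)) ≡ true
      extends-intro y p′ i eq
        rewrite snd-pair y (pair p′ i) | fst-pair p′ i | snd-pair p′ i | fst-pair p (pair t w) = ≡ᵇ-intro eq

  -- The complexity bound behind the diagonalisation: forcing a formula of level m is as simple as
  -- the formula. The condition p and the program t enter as constants.
  forceable-Π : ∀ m p t {A} → (∀ x → (A x ≡ true) ⇔ Forceable m p t x) → IsΠ Z (suc m) A
  forceable-Π m p t A⇔ =
    (λ v → matrix m (state p t (head v) ∷ tail v)) ,
    (program R-computable , computes R-computable) ,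
    λ x → mk⇔ (λ Ax → forceable-matrix m p t x (to (A⇔ x) Ax)) (λ al → from (A⇔ x) (matrix-forceable m p t x al))
    where
    R-computable = updateᶜ (pairᶜ (constᶜ p) (pairᶜ (constᶜ t) varᶜ)) (characteristic (matrixᵈ m))

  -- The generic path

  Decided : (m t w p : ℕ) → Set
  Decided m t w p = Forces m p t w ⊎ Refutes m p t w

  -- The set A enters through its code a, so that requirements are indexed by numbers. A code that
  -- defines no set, or one that is Π at the level in question, imposes nothing.
  Separated : (m t a p : ℕ) → Set
  Separated m t a p = Σ SetOfNat (λ A → (∀ x → (A x ≡ true) ⇔ Φ Z a x) × ¬ IsΠ Z (suc m) A) →
    Σ ℕ λ x → (Φ Z a x × Refutes m p t x) ⊎ (¬ Φ Z a x × Forces m p t x)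

  decide : ∀ m t w p → Consistent p → Extension p (Decided m t w)
  decide m t w p c with lem (Forceable m p t w)
  ... | inj₁ f = let p′ , ⊑p , c′ , f′ = forceable-extension m f in p′ , ⊑p , c′ , inj₁ f′
  ... | inj₂ nf = let p′ , ⊑p , c′ , r = ¬forceable-extension m c nf in p′ , ⊑p , c′ , inj₂ r

  separate : ∀ m t a p → Consistent p → Extension p (Separated m t a)
  separate m t a p c with lem (Σ SetOfNat (λ A → (∀ x → (A x ≡ true) ⇔ Φ Z a x) × ¬ IsΠ Z (suc m) A))
  ... | inj₂ none = p , ⊑-refl , c , λ e → contradiction e none
  ... | inj₁ (A , A⇔ , ¬Π) with ¬∀⇒∃¬ lem (λ h → ¬Π (forceable-Π m p t h))
  ... | x , ¬⇔ with lem (Φ Z a x) | lem (Forceable m p t x)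
  ... | inj₁ φ | inj₁ f = contradiction (mk⇔ (λ _ → f) (λ _ → from (A⇔ x) φ)) ¬⇔
  ... | inj₁ φ | inj₂ nf =
    let p′ , ⊑p , c′ , r = ¬forceable-extension m c nf in p′ , ⊑p , c′ , λ _ → x , inj₁ (φ , r)
  ... | inj₂ nφ | inj₁ f =
    let p′ , ⊑p , c′ , f′ = forceable-extension m f in p′ , ⊑p , c′ , λ _ → x , inj₂ (nφ , f′)
  ... | inj₂ nφ | inj₂ nf =
    contradiction (mk⇔ (λ Ax → contradiction (to (A⇔ x) Ax) nφ) (λ f → contradiction f nf)) ¬⇔

  Handled : (m t w a p : ℕ) → Set
  Handled m t w a p = Decided m t w p × Separated m t a p

  HandledCode : ℕ → ℕ → Set
  HandledCode r = Handled (fst (fst r)) (snd (fst r)) (fst (snd r)) (snd (snd r))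

  separated-⊑ : ∀ {m t a p p′} → p′ ⊑ p → Separated m t a p → Separated m t a p′
  separated-⊑ {m} p′⊑p s e with s e
  ... | x , inj₁ (φ , r) = x , inj₁ (φ , refutes-⊑ m p′⊑p r)
  ... | x , inj₂ (nφ , f) = x , inj₂ (nφ , forces-⊑ m p′⊑p f)

  handle : ∀ r p → Consistent p → Extension p (HandledCode r)
  handle r p c =
    let p′ , ⊑p , c′ , s = separate (fst (fst r)) (snd (fst r)) (snd (snd r)) p c
        p″ , ⊑p′ , c″ , d = decide (fst (fst r)) (snd (fst r)) (fst (snd r)) p′ c′
    in p″ , ⊑-trans ⊑p′ ⊑p , c″ , d , separated-⊑ ⊑p′ s

  prefix-mono : ∀ G {m n} → m ≤ n → T (prefix G n) ≡ true → T (prefix G m) ≡ true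
  prefix-mono G {m} m≤n t =
    let τ , eq = split G m≤n in tree (prefix G m) τ (subst (λ σ → T σ ≡ true) eq t)
    where
    split : ∀ (G : ℕ → Bool) {m n} → m ≤ n → Σ (List Bool) λ τ → prefix G n ≡ prefix G m ++ τ
    split G {n = n} z≤n = prefix G n , refl
    split G (s≤s m≤n) = let τ , eq = split (G ∘ suc) m≤n in τ , cong (G 0 ∷_) eq

  prefix-local : ∀ {G H : ℕ → Bool} n → (∀ i → i < n → G i ≡ H i) → prefix G n ≡ prefix H n
  prefix-local zero h = refl
  prefix-local (suc n) h = cong₂ _∷_ (h 0 (s≤s z≤n)) (prefix-local n (λ i i<n → h (suc i) (s≤s i<n)))

  root-consistent : Consistent 0
  root-consistent n with inf n
  ... | σ , n≤ , Tσ = string σ , tree-below , λ e → no-constraint (proj₁ (proj₂ (excludes-elim e)))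
    where
    string : List Bool → ℕ → Bool
    string [] _ = false
    string (b ∷ σ) zero = b
    string (b ∷ σ) (suc i) = string σ i
    prefix-string : ∀ σ → prefix (string σ) (length σ) ≡ σ
    prefix-string [] = refl
    prefix-string (b ∷ σ) = cong (b ∷_) (prefix-string σ)
    tree-below : T (prefix (string σ) n) ≡ true
    tree-below = prefix-mono (string σ) n≤ (trans (cong T (prefix-string σ)) Tσ)
    no-constraint : ∀ {θ} → ¬ θ ∈ₚ 0
    no-constraint (at i eq nz) = nz (trans (sym eq) (nth-0 i))

  stage : ℕ → Σ ℕ Consistent
  stage zero = 0 , root-consistent
  stage (suc r) = let p , c = stage r ; p′ , _ , c′ , _ = handle r p c in p′ , c′

  condition : ℕ → ℕ
  condition r = proj₁ (stage r)

  condition-consistent : ∀ r → Consistent (condition r)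
  condition-consistent r = proj₂ (stage r)

  condition-⊑ : ∀ {r s} → r ≤ s → condition s ⊑ condition r
  condition-⊑ {r} {s} r≤s = go (≤⇒≤′ r≤s)
    where
    go : ∀ {s} → r ≤′ s → condition s ⊑ condition r
    go ≤′-refl = ⊑-refl
    go (≤′-step {s} le) = ⊑-trans (proj₁ (proj₂ (handle s (condition s) (condition-consistent s)))) (go le)

  -- Stage r serves the requirement whose code is r. Once is enough, because forcing and refuting
  -- persist under extension.
  handled : ∀ m t w a → Σ ℕ λ r → Handled m t w a (condition r)
  handled m t w a =
    suc r , uncode (proj₂ (proj₂ (proj₂ (handle r (condition r) (condition-consistent r)))))
    where
    r : ℕ
    r = pair (pair m t) (pair w a)
    uncode : ∀ {p} → HandledCode r p → Handled m t w a p
    uncode h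
      rewrite fst-pair (pair m t) (pair w a) | snd-pair (pair m t) (pair w a)
            | fst-pair m t | snd-pair m t | fst-pair w a | snd-pair w a = h

  -- Compactness: one path through all conditions

  Node : ℕ → (ℕ → Bool) → Set
  Node n H = T (prefix H n) ≡ true × (∀ s → s ≤ n → ¬ excludes (condition s) (Z ⊕ H) n ≡ true)

  Agree : ℕ → (ℕ → Bool) → (ℕ → Bool) → Set
  Agree n G H = ∀ i → i < n → G i ≡ H i

  node-mono : ∀ {H m n} → m ≤ n → Node n H → Node m H
  node-mono {H} m≤n (t , ne) =
    prefix-mono H m≤n t , λ s s≤m e → ne s (≤-trans s≤m m≤n) (excludes-mono m≤n (λ _ _ → refl) e)

  node-local : ∀ {G H n} → Agree n G H → Node n H → Node n G
  node-local {G} {H} {n} G≈H (t , ne) =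
    trans (cong T (prefix-local n G≈H)) t ,
    λ s s≤n e → ne s s≤n (excludes-mono ≤-refl (⊕-local Z G≈H) e)

  node-exists : ∀ n → Σ (ℕ → Bool) (Node n)
  node-exists n =
    let G , t , ne = condition-consistent n n
    in G , t , λ s s≤n e →
         let θ , θ∈ , v = excludes-elim e in ne (excludes-intro (∈ₚ-⊑ (condition-⊑ s≤n) θ∈) v)

  Live : ℕ → (ℕ → Bool) → Set
  Live n g = ∀ N → Σ (ℕ → Bool) λ H → Agree n g H × Node N H

  update : ℕ → Bool → (ℕ → Bool) → ℕ → Bool
  update n b g i = if i ≡ᵇ n then b else g i

  update-other : ∀ n b g {i} → i < n → update n b g i ≡ g i
  update-other n b g {i} i<n with i ≡ᵇ n in eq
  ... | true = contradiction (≡ᵇ-elim i n eq) (<⇒≢ i<n)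
  ... | false = refl

  update-agree : ∀ n {g H} → Agree n g H → Agree (suc n) (update n (H n) g) H
  update-agree n {g} {H} g≈H i i<sn with m≤n⇒m<n∨m≡n (≤-pred i<sn)
  ... | inj₁ i<n = trans (update-other n (H n) g i<n) (g≈H i i<n)
  ... | inj₂ refl rewrite ≡ᵇ-refl i = refl

  -- The step of weak König's lemma: if both one-bit extensions died, at lengths M and N, a node of
  -- length `M ⊔ N` above g would have to pass through one of them.
  live-step : ∀ n g → Live n g → Σ Bool λ b → Live (suc n) (update n b g)
  live-step n g live with lem (Live (suc n) (update n true g)) | lem (Live (suc n) (update n false g))
  ... | inj₁ l | _ = true , l
  ... | inj₂ _ | inj₁ l = false , l
  ... | inj₂ dead₁ | inj₂ dead₂ with ¬∀⇒∃¬ lem dead₁ | ¬∀⇒∃¬ lem dead₂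
  ... | M , none₁ | N , none₂ with live (M ⊔ N)
  ... | H , g≈H , node with H n in eq
  ... | true = contradiction
    (H , subst (λ b → Agree (suc n) (update n b g) H) eq (update-agree n g≈H) , node-mono (m≤m⊔n M N) node) none₁
  ... | false = contradiction
    (H , subst (λ b → Agree (suc n) (update n b g) H) eq (update-agree n g≈H) , node-mono (m≤n⊔m M N) node) none₂

  branch : ∀ n → Σ (ℕ → Bool) (Live n)
  branch zero = (λ _ → false) , λ N → let H , node = node-exists N in H , (λ i ()) , node
  branch (suc n) = let g , live = branch n ; b , live′ = live-step n g live in update n b g , live′

  path : SetOfNat
  path i = proj₁ (branch (suc i)) i

  branch-path : ∀ n → Agree n path (proj₁ (branch n))
  branch-path n i i<n = go (≤⇒≤′ i<n)
    where
    go : ∀ {n} → suc i ≤′ n → path i ≡ proj₁ (branch n) i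
    go ≤′-refl = refl
    go (≤′-step {n} le) = trans (go le) (sym (update-other n _ (proj₁ (branch n)) (≤′⇒≤ le)))

  path-node : ∀ n → Node n path
  path-node n =
    let H , g≈H , node = proj₂ (branch n) n
    in node-local (λ i i<n → trans (branch-path n i i<n) (g≈H i i<n)) node

  X : SetOfNat
  X = Z ⊕ path

  path-admitted : ∀ r n → ¬ excludes (condition r) X n ≡ true
  path-admitted r n e =
    -- Level `r ⊔ n` is late enough for condition r to be imposed and for a violation seen at n to
    -- persist.
    proj₂ (path-node (r ⊔ n)) r (m≤m⊔n r n) (excludes-mono (m≤n⊔m r n) (λ _ _ → refl) e)

  -- Truth along the path

  Holds : ℕ → (t w : ℕ) → Set
  Holds zero t w = ∀ n → ¬ violates X n (pair t w) ≡ true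
  Holds (suc m) t w = ∀ y → ¬ Holds m t (pair y w)

  mutual
    -- If a formula under a forced negation held, look at the stage that decides it. A refutation is
    -- excluded by induction, and if it were forced, the later of the two stages would be a
    -- consistent extension contradicting the forced negation.
    forces-holds : ∀ m r {t w} → Forces m (condition r) t w → Holds m t w
    forces-holds zero r θ∈ n v = path-admitted r n (excludes-intro θ∈ v)
    forces-holds (suc m) r {t} {w} f y h with handled m t (pair y w) 0
    ... | s , inj₂ ref , _ = refutes-fails m s ref h
    ... | s , inj₁ f′ , _ =
      f y (condition (r ⊔ s)) (condition-⊑ (m≤m⊔n r s))
        (forces-forceable m (condition-consistent (r ⊔ s)) (forces-⊑ m (condition-⊑ (m≤n⊔m r s)) f′))

    refutes-fails : ∀ m r {t w} → Refutes m (condition r) t w → ¬ Holds m t w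
    -- If the constraint held, `path` itself would witness at every length that it can be added
    -- consistently.
    refutes-fails zero r {t} {w} nc h = nc λ n → path , proj₁ (path-node n) , λ e →
        let θ , θ∈ , v = excludes-elim e in absurd n (∈ₚ-cons θ∈) v
      where
      absurd : ∀ n {θ} → θ ≡ pair t w ⊎ θ ∈ₚ condition r → ¬ violates X n θ ≡ true
      absurd n (inj₁ refl) v = h n v
      absurd n (inj₂ θ∈) v = path-admitted r n (excludes-intro θ∈ v)
    refutes-fails (suc m) r (y , f) h = h y (forces-holds m r f)

  -- Normal form of the Π sets relative to X

  -- push x (y₁, …, yₙ) nests as pair yₙ (… (pair y₁ x)), the order in which Holds adds parameters.
  push : ∀ {n} → ℕ → Vec ℕ n → ℕ
  push w [] = w
  push w (y ∷ ys) = push (pair y w) ys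

  get : ∀ n → Fin (suc n) → ℕ → ℕ
  get zero zero e = e
  get (suc n) zero e = snd (get n zero e)
  get (suc n) (suc zero) e = fst (get n zero e)
  get (suc n) (suc (suc i)) e = get n (suc i) e

  get-push : ∀ n x (ys : Vec ℕ n) i → get n i (push x ys) ≡ lookup (x ∷ ys) i
  get-push zero x [] zero = refl
  get-push (suc n) x (y ∷ ys) zero = trans (cong snd (get-push n (pair y x) ys zero)) (snd-pair y x)
  get-push (suc n) x (y ∷ ys) (suc zero) = trans (cong fst (get-push n (pair y x) ys zero)) (fst-pair y x)
  get-push (suc n) x (y ∷ ys) (suc (suc i)) = get-push n (pair y x) ys (suc i)

  getᶜ : ∀ n i → Computable X {1} (λ v → get n i (head v))
  getᶜ zero zero = varᶜ
  getᶜ (suc n) zero = sndᶜ (getᶜ n zero)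
  getᶜ (suc n) (suc zero) = fstᶜ (getᶜ n zero)
  getᶜ (suc n) (suc (suc i)) = getᶜ n (suc i)

  -- Pushing the negations of `Holds m` into the matrix flips the output b once per quantifier, m +
  -- 1 times in all. A suitable b makes the matrix come out as asserted.
  sign : ℕ → Bool → Bool
  sign zero b = not b
  sign (suc m) b = not (sign m b)

  sign-surjective : ∀ m β → Σ Bool λ b → sign m b ≡ β
  sign-surjective zero β = not β , not-involutive β
  sign-surjective (suc m) β =
    let b , eq = sign-surjective m (not β) in b , trans (cong not eq) (not-involutive β)

  violates⇔ : ∀ c b w → (Σ ℕ λ n → violates X n (pair (pair c b) w) ≡ true) ⇔
    (Σ ℕ λ y → Σ ℕ λ n → converges X n c (pair (pair y w) 0) b ≡ true)
  violates⇔ c b w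
    rewrite fst-pair (pair c b) w | snd-pair (pair c b) w | fst-pair c b | snd-pair c b = mk⇔
    (λ (n , v) → let y , _ , q = any<-elim n v in y , n , q)
    (λ (y , n , q) → n ⊔ suc y , any<-intro (n ⊔ suc y) y (m≤n⊔m n (suc y))
      (converges-mono (m≤m⊔n n (suc y)) (λ _ _ → refl) c (pair (pair y w) 0) b q))

  holds-form : ∀ m c b w (S : Vec ℕ (suc m) → Bool) →
    (∀ ys β → S ys ≡ β ⇔ (Σ ℕ λ n → converges X n c (pair (push w ys) 0) (b2n β) ≡ true)) →
    Holds m (pair c (b2n b)) w ⇔ AllForm (suc m) (λ ys → S ys ≡ sign m b)
  holds-form zero c b w S S⇔ = mk⇔
    (λ h y → ¬-not λ eq →
      let n , v = from (violates⇔ c (b2n b) w) (y , to (S⇔ (y ∷ []) b) eq) in h n v)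
    (λ al n v → let y , q = to (violates⇔ c (b2n b) w) (n , v) in not-¬ (from (S⇔ (y ∷ []) b) q) (al y))
  holds-form (suc m) c b w S S⇔ = mk⇔
    (λ h y → to (negation y) λ al → h y (from (IH y) al))
    (λ al y h → from (negation y) (al y) (to (IH y) h))
    where
    IH : ∀ y → Holds m (pair c (b2n b)) (pair y w) ⇔ AllForm (suc m) (λ ys → S (y ∷ ys) ≡ sign m b)
    IH y = holds-form m c b (pair y w) (λ ys → S (y ∷ ys)) (λ ys → S⇔ (y ∷ ys))
    negation = λ y → ¬allForm-bool lem (suc m) (λ ys → S (y ∷ ys)) (sign m b)

  -- Constraints test unary programs, `pair e 0` being the code of the one-entry vector. So all
  -- variables are packed into one number by `push`, and the program is composed with `get` to
  -- unpack them.
  Π-holds : ∀ m {A} → IsΠ X (suc m) A → Σ ℕ λ t → ∀ x → (A x ≡ true) ⇔ Holds m t x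
  Π-holds m {A} (R , (c , ev) , A⇔) with sign-surjective m true
  ... | b , sign≡true = pair (codePR (program S)) (b2n b) , λ x →
    let H⇔ = subst (λ β → Holds m (pair (codePR (program S)) (b2n b)) x ⇔ AllForm (suc m) (λ ys → R (x ∷ ys) ≡ β))
               sign≡true (holds-form m (codePR (program S)) b x (λ ys → R (x ∷ ys)) (value x))
    in mk⇔ (λ Ax → from H⇔ (to (A⇔ x) Ax)) (λ h → from (A⇔ x) (to H⇔ h))
    where
    S : Computable X {1} (λ v → b2n (R (tabulate (λ i → get (suc m) i (head v)))))
    S = compose (λ i v → get (suc m) i (head v)) (computable c ev) (getᶜ (suc m))
    value : ∀ x ys β → R (x ∷ ys) ≡ β ⇔
      (Σ ℕ λ n → converges X n (codePR (program S)) (pair (push x ys) 0) (b2n β) ≡ true)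
    value x ys β = subst
      (λ u → R u ≡ β ⇔ (Σ ℕ λ n → converges X n (codePR (program S)) (pair (push x ys) 0) (b2n β) ≡ true))
      (trans (tabulate-cong (get-push (suc m) x ys)) (tabulate∘lookup (x ∷ ys)))
      (converges-value {R = λ v → R (tabulate (λ i → get (suc m) i (head v)))} (computes S) (push x ys ∷ []) β)

  -- The definition over X supplies t and the definition over Z supplies a. If A were not Π in Z at
  -- this level, the requirement for t and a would give an x where truth on the path disagrees with
  -- A.
  Π-reflection : ∀ m {A a} → (∀ x → (A x ≡ true) ⇔ Φ Z a x) → IsΠ X (suc m) A → IsΠ Z (suc m) A
  Π-reflection m {A} {a} A⇔ Π with lem (IsΠ Z (suc m) A)
  ... | inj₁ ΠZ = ΠZ
  ... | inj₂ ¬Π with Π-holds m Π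
  ... | t , H⇔ with handled m t 0 a
  ... | r , _ , s with s (A , A⇔ , ¬Π)
  ... | x , inj₁ (φ , ref) = contradiction (to (H⇔ x) (from (A⇔ x) φ)) (refutes-fails m r ref)
  ... | x , inj₂ (nφ , f) = contradiction (to (A⇔ x) (from (H⇔ x) (forces-holds m r f))) nφ

-- Elementary closure properties of the hierarchy

complement : SetOfNat → SetOfNat
complement A x = not (A x)

module _ (lem : LEM) {X : SetOfNat} where

  notR : ∀ {k} {R : Vec ℕ k → Bool} → ComputableRel X k R → ComputableRel X k (λ v → not (R v))
  notR (c , ev) = let dR = characteristic (notᵈ (decidable (computable c ev))) in program dR , computes dR

  Σ-complement : ∀ {n A} → IsΣ X n A → IsΠ X n (complement A)
  Σ-complement {n} {A} (R , cR , A⇔) = (λ v → not (R v)) , notR cR , λ x → mk⇔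
    (λ nA → allForm-map n (λ _ → not-intro) (¬exForm lem n λ e → not-elim nA (from (A⇔ x) e)))
    (λ al → not-intro λ Ax → let _ , p , q = exForm-allForm-meet n (to (A⇔ x) Ax) al in not-elim q p)

  Π-complement : ∀ {n A} → IsΠ X n A → IsΣ X n (complement A)
  Π-complement {n} {A} (R , cR , A⇔) = (λ v → not (R v)) , notR cR , λ x → mk⇔
    (λ nA → exForm-map n (λ _ → not-intro) (¬allForm lem n λ al → not-elim nA (from (A⇔ x) al)))
    (λ ex → not-intro λ Ax → let _ , p , q = exForm-allForm-meet n ex (to (A⇔ x) Ax) in not-elim p q)

  Σ-complement⁻¹ : ∀ {n A} → IsΠ X n (complement A) → IsΣ X n A
  Σ-complement⁻¹ {n} {A} Π = let R , cR , A⇔ = Π-complement Π in R , cR , λ x →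
    subst (λ a → (a ≡ true) ⇔ ExForm n (λ ys → R (x ∷ ys) ≡ true)) (not-involutive (A x)) (A⇔ x)

  -- A vacuous universal quantifier is put in front, and the matrix skips its variable.
  Σ⇒Π-suc : ∀ {n A} → IsΣ X n A → IsΠ X (suc n) A
  Σ⇒Π-suc {n} {A} (R , (c , ev) , A⇔) =
    (λ v → R (head v ∷ tail (tail v))) , (program S , computes S) , λ x → mk⇔
      (λ Ax y → to (A⇔ x) Ax)
      (λ al → from (A⇔ x) (al 0))
    where
    S = skipᶜ (computable {f = λ v → b2n (R v)} c ev)

-- Transfer of definitions from an oracle to a join

module _ {Z : SetOfNat} (Y : SetOfNat) where

  join-even : ∀ x → (Z ⊕ Y) (x + x) ≡ Z x
  join-even x = trans (⊕-half Z Y (x + x))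
    (cong₂ (λ b m → if b then Y m else Z m)
      (trans (cong odd x+x) (odd-double false x)) (trans (cong half x+x) (half-double false x)))
    where
    x+x : x + x ≡ 2 * x
    x+x = cong (x +_) (sym (+-identityʳ x))

  evenOracle : Computable (Z ⊕ Y) {1} (λ v → b2n ((Z ⊕ Y) (head v + head v)))
  evenOracle = characteristic (oracleᶜ (varᶜ +ᶜ varᶜ))

  lift : ∀ {k} → PR k → PR k
  lift zer = zer
  lift succ = succ
  lift (proj i) = proj i
  lift orc = program evenOracle
  lift (comp f gs) = comp (lift f) (λ i → lift (gs i))
  lift (prec g h) = prec (lift g) (lift h)
  lift (mu f) = mu (lift f)

  lift-eval : ∀ {k} {c : PR k} {v z} → Eval Z c v z → Eval (Z ⊕ Y) (lift c) v z
  lift-eval e-zer = e-zer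
  lift-eval e-succ = e-succ
  lift-eval e-proj = e-proj
  lift-eval (e-orc {x}) =
    subst (λ b → Eval (Z ⊕ Y) (program evenOracle) (x ∷ []) (b2n b)) (join-even x) (computes evenOracle (x ∷ []))
  lift-eval (e-comp E F) = e-comp (λ i → lift-eval (E i)) (lift-eval F)
  lift-eval (e-prec0 G) = e-prec0 (lift-eval G)
  lift-eval (e-precS P H) = e-precS (lift-eval P) (lift-eval H)
  lift-eval (e-mu F P) = e-mu (lift-eval F) (λ z z<y → proj₁ (P z z<y) , lift-eval (proj₂ (P z z<y)))

  Σ-join : ∀ {n A} → IsΣ Z n A → IsΣ (Z ⊕ Y) n A
  Σ-join (R , (c , ev) , A⇔) = R , (lift c , λ v → lift-eval (ev v)) , A⇔

  Π-join : ∀ {n A} → IsΠ Z n A → IsΠ (Z ⊕ Y) n A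
  Π-join (R , (c , ev) , A⇔) = R , (lift c , λ v → lift-eval (ev v)) , A⇔

theorem3p6 : LEM → (Z : SetOfNat) → (T : List Bool → Bool) → ComputableTree Z T → IsTree T → InfiniteTree T → Σ SetOfNat (λ G → IsPath T G × PreservesAH Z G)
theorem3p6 lem Z T cT tree inf = path , (λ n → proj₁ (path-node n)) , preserves
  where
  open Forcing lem Z T cT tree inf

  -- The levels n and m are independent, since the definition over Z only supplies a code. A
  -- properly Σ set can therefore be presented as Π one level higher and still be reflected at its
  -- own level.
  Π-reflect : ∀ m {A n} → IsΠ Z n A → IsΠ X (suc m) A → IsΠ Z (suc m) A
  Π-reflect m Π = Π-reflection m {a = proj₁ (Π-coded Π)} (proj₂ (Π-coded Π))

  Σ-reflect : ∀ m {A n} → IsΣ Z n A → IsΣ X (suc m) A → IsΣ Z (suc m) A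
  Σ-reflect m S S′ = Σ-complement⁻¹ lem (Π-reflect m (Σ-complement lem S) (Σ-complement lem S′))

  Π⇒Σ-suc : ∀ {n A} → IsΠ Z n A → IsΣ Z (suc n) A
  Π⇒Σ-suc Π = Σ-complement⁻¹ lem (Σ⇒Π-suc lem (Π-complement lem Π))

  preserves : PreservesAH Z path
  preserves (suc m) _ =
    (λ A (S , ¬Π) → Σ-join path S , λ Π → ¬Π (Π-reflect m (Σ⇒Π-suc lem S) Π)) ,
    (λ A (Π , ¬S) → Π-join path Π , λ S → ¬S (Σ-reflect m (Π⇒Σ-suc Π) S)) ,
    (λ A ((S , Π) , ¬S , ¬Π) → (Σ-join path S , Π-join path Π) ,
      (λ S′ → ¬S (Σ-reflect m S S′)) , (λ Π′ → ¬Π (Π-reflect m Π Π′)))
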